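{- A completable queue implementation is linearizable (with respect to the queue specification) if and only if none of its complete induced histories has a $\mathsf{VFresh}$, $\mathsf{VRepet}$, $\mathsf{VOrd}$ or $\mathsf{VWit}$ violation.
   Context: Queue events, histories: an event is a tuple $(u,m,d_{in},d_{out})$ with unique identifier $u$, $m\in\{\mathtt{enq},\mathtt{deq}\}$; $\mathtt{enq}(x)$ enqueues $x\in\mathbb{N}$, $\mathtt{deq}(x)$ returns $x\in\mathbb{N}\cup\{\mathtt{NULL}\}$. Each event has invocation $\mathit{inv}$ and response $\mathit{res}$; a history is a finite sequence of such actions, each at most once, responses after invocations; an event is pending if only invoked; a history is complete if none is pending. $e\prec_c e'$ iff $\mathit{res}(e)$ precedes $\mathit{inv}(e')$. A completion of $c$ is a complete history obtained from $c\cdot c'$, with $c'$ consisting only of response actions, by deleting actions of still-pending events; $\mathrm{Compl}(c)$ is the set of completions. A behavior (event sequence) is legal if it labels a run from $\varepsilon$ of $\mathsf{LTS}_Q$ (states: finite sequences over $\mathbb{N}$; $q\xrightarrow{\mathtt{enq}(x)}q\cdot x$, $x\cdot q'\xrightarrow{\mathtt{deq}(x)}q'$, $\varepsilon\xrightarrow{\mathtt{deq}(\mathtt{NULL})}\varepsilon$). A history $c$ is linearizable if some $\hat c\in\mathrm{Compl}(c)$ admits a legal ordering $s$ of its events with $e\prec_{\hat c}e'\Rightarrow e$ before $e'$ in $s$. An implementation is a set of execution traces, each inducing a history (invocation at method entry, response at method exit); it is linearizable if all its induced histories are, and completable if for every induced history $c$, $\mathrm{Compl}(c)$ contains some induced history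 of the implementation. Each value is assumed enqueued at most once. Violations of a complete history $c$ (with $\mathrm{Enq}(c)$, $\mathrm{Deq}(c)$, $\mathrm{Val}(c,e)$ its enqueue events, dequeue events, and event values): ($\mathsf{VFresh}$) some $x\neq\mathtt{NULL}$ has $\mathtt{deq}(x)\in\mathrm{Deq}(c)$ and either $\mathtt{enq}(x)\notin\mathrm{Enq}(c)$ or $\mathtt{deq}(x)\prec_c\mathtt{enq}(x)$; ($\mathsf{VRepet}$) distinct $d,d'\in\mathrm{Deq}(c)$ with $\mathrm{Val}(c,d)=\mathrm{Val}(c,d')\neq\mathtt{NULL}$; ($\mathsf{VOrd}$) values $x,y$ with $\mathtt{enq}(y)\prec_c\mathtt{enq}(x)$, $\mathtt{deq}(x)\in\mathrm{Deq}(c)$, and either no dequeue of $y$ in $c$ or $\mathtt{deq}(x)\prec_c\mathtt{deq}(y)$; ($\mathsf{VWit}$) a dequeue $d$ returning $\mathtt{NULL}$ with $c=c_0\cdot\mathit{inv}(d)\cdot c_d\cdot\mathit{res}(d)\cdot c_3$ such that for every split $c_d=c_1\cdot c_2$ some $\mathtt{enq}(x)$ is completed in $c_0\cdot\mathit{inv}(d)\cdot c_1$ while no dequeue returning $x$ is invoked in $c_0\cdot\mathit{inv}(d)\cdot c_1$. -}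

module Defs where

open import Data.Nat using (ℕ; _≡ᵇ_)
open import Data.Bool using (Bool; true; false)
open import Data.Maybe using (Maybe; just; nothing)
open import Data.List using (List; []; _∷_; _++_; [_]; filterᵇ; map)
open import Data.Bool.ListAction using (any)
open import Data.List.Membership.Propositional using (_∈_)
open import Data.List.Relation.Unary.All using (All)
open import Data.List.Relation.Unary.Unique.Propositional using (Unique)
open import Data.Product using (Σ; ∃; ∃-syntax; _×_; _,_; proj₁)
open import Data.Sum using (_⊎_)
open import Data.Empty using (⊥)
open import Relation.Nullary using (¬_)
open import Relation.Binary.PropositionalEquality using (_≡_; _≢_)

-- Actions of histories.
-- An event has a unique identifier u : ℕ.  Its invocation action carries
-- the method and input (enq x, or deq); its response action carries the
-- output (ok for enq, a value or NULL = nothing for deq).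

data Op : Set where
  enq : ℕ → Op
  deq : Op

data Ret : Set where
  ok  : Ret
  ret : Maybe ℕ → Ret      -- response of a dequeue (nothing = NULL)

data Action : Set where
  inv : ℕ → Op → Action
  res : ℕ → Ret → Action

data Matches : Op → Ret → Set where
  enq-ok  : ∀ x → Matches (enq x) ok
  deq-ret : ∀ r → Matches deq (ret r)

data Label : Set where
  enqL : ℕ → Label
  deqL : Maybe ℕ → Label

Event : Set
Event = ℕ × Label

History : Set
History = List Action

Before : {A : Set} → List A → A → A → Set
Before {A} xs a b =
  Σ (List A) λ p → Σ (List A) λ q → Σ (List A) λ r → xs ≡ p ++ a ∷ q ++ b ∷ r

record WF (h : History) : Set where
  field
    inv-once : ∀ p q r u o o' → h ≢ p ++ inv u o ∷ q ++ inv u o' ∷ r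
    res-once : ∀ p q r u t t' → h ≢ p ++ res u t ∷ q ++ res u t' ∷ r
    res-after-inv : ∀ p u t q → h ≡ p ++ res u t ∷ q →
                    ∃[ o ] (inv u o ∈ p × Matches o t)

Complete : History → Set
Complete h = ∀ u o → inv u o ∈ h → ∃[ t ] (res u t ∈ h)

Prec : History → ℕ → ℕ → Set
Prec h u v = ∃[ t ] ∃[ o ] Before h (res u t) (inv v o)

data IsResponse : Action → Set where
  isRes : ∀ u t → IsResponse (res u t)

idOf : Action → ℕ
idOf (inv u _) = u
idOf (res u _) = u

isResOf : ℕ → Action → Bool
isResOf u (inv _ _) = false
isResOf u (res v _) = u ≡ᵇ v

dropPending : History → History
dropPending h = filterᵇ (λ a → any (isResOf (idOf a)) h) h

Compl : History → History → Set
Compl c ĉ = ∃[ c' ] (All IsResponse c' × WF (c ++ c') × ĉ ≡ dropPending (c ++ c'))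

data Step : List ℕ → Label → List ℕ → Set where
  enqS  : ∀ q x → Step q (enqL x) (q ++ [ x ])
  deqS  : ∀ x q → Step (x ∷ q) (deqL (just x)) q
  nullS : Step [] (deqL nothing) []

data Run : List ℕ → List Label → Set where
  done : ∀ q → Run q []
  step : ∀ {q l q' ls} → Step q l q' → Run q' ls → Run q (l ∷ ls)

Legal : List Label → Set
Legal ls = Run [] ls

EventOf : History → Event → Set
EventOf h (u , enqL x) = inv u (enq x) ∈ h × res u ok ∈ h
EventOf h (u , deqL r) = inv u deq ∈ h × res u (ret r) ∈ h

LegalOrdering : History → List Event → Set
LegalOrdering h s =
  (∀ e → e ∈ s → EventOf h e) ×
  (∀ e → EventOf h e → e ∈ s) ×
  Unique s ×
  Legal (map Data.Product.proj₂ s) ×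
  (∀ e e' → e ∈ s → e' ∈ s → Prec h (proj₁ e) (proj₁ e') → Before s e e')

Linearizable : History → Set
Linearizable c = ∃[ ĉ ] (Compl c ĉ × ∃[ s ] LegalOrdering ĉ s)

-- Implementations, abstracted by the set of their induced histories.

Implementation : Set₁
Implementation = History → Set

LinearizableImpl : Implementation → Set
LinearizableImpl I = ∀ c → I c → Linearizable c

Completable : Implementation → Set
Completable I = ∀ c → I c → ∃[ ĉ ] (Compl c ĉ × I ĉ)

EnqOnce : History → Set
EnqOnce h = ∀ u u' x → inv u (enq x) ∈ h → inv u' (enq x) ∈ h → u ≡ u'

EnqE : History → ℕ → ℕ → Set
EnqE c u x = inv u (enq x) ∈ c

DeqE : History → ℕ → Maybe ℕ → Set
DeqE c d r = inv d deq ∈ c × res d (ret r) ∈ c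

VFresh : History → Set
VFresh c = ∃[ x ] ∃[ d ] (DeqE c d (just x) ×
  ((∀ u → ¬ EnqE c u x) ⊎ (∃[ u ] (EnqE c u x × Prec c d u))))

VRepet : History → Set
VRepet c = ∃[ d ] ∃[ d' ] ∃[ x ] (d ≢ d' × DeqE c d (just x) × DeqE c d' (just x))

VOrd : History → Set
VOrd c = ∃[ x ] ∃[ y ] ∃[ ex ] ∃[ ey ] ∃[ dx ]
  (EnqE c ex x × EnqE c ey y × Prec c ey ex × DeqE c dx (just x) ×
   ((∀ dy → ¬ DeqE c dy (just y)) ⊎ (∃[ dy ] (DeqE c dy (just y) × Prec c dx dy))))

VWit : History → Set
VWit c = ∃[ d ] ∃[ c₀ ] ∃[ cd ] ∃[ c₃ ]
  (c ≡ c₀ ++ inv d deq ∷ cd ++ res d (ret nothing) ∷ c₃ ×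
   (∀ c₁ c₂ → cd ≡ c₁ ++ c₂ →
     ∃[ x ] ∃[ u ]
       (inv u (enq x) ∈ (c₀ ++ inv d deq ∷ c₁) ×
        res u ok ∈ (c₀ ++ inv d deq ∷ c₁) ×
        (∀ d' r → inv d' deq ∈ (c₀ ++ inv d deq ∷ c₁) → res d' (ret r) ∈ c → r ≢ just x))))

Violation : History → Set
Violation c = VFresh c ⊎ VRepet c ⊎ VOrd c ⊎ VWit c

{-# OPTIONS --safe #-}
-- For a complete history h, Compl h = {h}.  In a legal ordering the values enqueued by any prefix
-- are those it dequeues followed by the contents of the queue; this excludes every violation.
--
-- Conversely, give every value x two intervals of positions in h,
--   enqueue in [inv enq x , min (res enq x) (res deq x)],
--   dequeue in [max (inv enq x) (inv deq x) , res deq x],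
-- and every NULL dequeue twice the one-point interval at a moment where the queue can be empty,
-- which exists since there is no VWit violation.  Excluding violations means that there are no
-- x, y with the first interval of x before that of y but the second of y before that of x.  Such a pair
-- of interval orders has a common minimum: among the elements whose first interval starts before the
-- earliest end of a first interval, take the one whose second interval starts earliest.  So the
-- elements can be listed compatibly with both orders.  Performing the enqueues, and the dequeues,
-- in this order, each at the earliest time allowed, gives a run of the queue inside all intervals.
module Submission where

open import Defs
open import Data.Bool using (T; T?)
open import Data.Bool.ListAction using (any)
open import Data.Empty using (⊥; ⊥-elim)
open import Data.List using (List; []; _∷_; _++_; [_]; length; map; take; drop; filter; concatMap)
open import Data.List.Extrema.Nat using (argmin; argmin-sel; f[argmin]≤f[⊤]; f[argmin]≤f[xs])
open import Data.List.Membership.Propositional using (_∈_; find; lose)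
open import Data.List.Membership.Propositional.Properties using
  (∈-∃++; ∈-++⁺ˡ; ∈-++⁺ʳ; ∈-++⁻; ∈-insert; ∈-filter⁺; ∈-filter⁻; ∈-map⁺; ∈-map⁻; ∈-concatMap⁺; ∈-concatMap⁻)
open import Data.List.Properties using
  (map-++; map-∘; ++-assoc; ++-identityʳ; length-++; length-take; take++drop≡id; filter-all)
open import Data.List.Relation.Binary.Permutation.Propositional using
  (_↭_; ↭-refl; ↭-sym; ↭-trans; ↭-reflexive; prep; ↭⇒↭ₛ)
open import Data.List.Relation.Binary.Permutation.Propositional.Properties using
  (shift; All-resp-↭; ∈-resp-↭; ↭-length)
import Data.List.Relation.Binary.Permutation.Setoid.Properties as Permₛ
open import Data.List.Relation.Binary.Pointwise using (Pointwise; []; _∷_)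
open import Data.List.Relation.Unary.All as All using (All; []; _∷_)
import Data.List.Relation.Unary.All.Properties as Allₚ
open import Data.List.Relation.Unary.AllPairs as AllPairs using (AllPairs; []; _∷_)
import Data.List.Relation.Unary.AllPairs.Properties as AllPairsₚ
open import Data.List.Relation.Unary.Any as Any using (Any; here; there)
open import Data.List.Relation.Unary.Any.Properties using (any⁺; any⁻)
open import Data.List.Relation.Unary.Unique.Propositional using (Unique)
open import Data.Maybe using (just; nothing)
open import Data.Nat
open import Data.Nat.Properties
open import Data.Product using (∃-syntax; _×_; _,_; proj₁; proj₂)
open import Data.Sum using (_⊎_; inj₁; inj₂)
open import Data.Unit using (⊤; tt)
open import Function.Base using (_∘_)
open import Function.Bundles using (_⇔_; mk⇔)
open import Relation.Binary.Definitions using (Symmetric; tri<; tri≈; tri>)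
open import Relation.Binary.PropositionalEquality hiding ([_])
open import Relation.Nullary using (¬_; Dec; yes; no)

private variable
  A B : Set
  xs : List A
  z z' : A
  i j : ℕ

-- Positions in lists and the order they induce.

data At {A : Set} : List A → ℕ → A → Set where
  here  : At (z ∷ xs) 0 z
  there : At xs i z → At (z' ∷ xs) (suc i) z

at-functional : At xs i z → At xs i z' → z ≡ z'
at-functional here here = refl
at-functional (there p) (there q) = at-functional p q

at⇒∈ : At xs i z → z ∈ xs
at⇒∈ here = here refl
at⇒∈ (there p) = there (at⇒∈ p)

∈⇒at : z ∈ xs → ∃[ i ] At xs i z
∈⇒at (here refl) = 0 , here
∈⇒at (there m) = let i , p = ∈⇒at m in suc i , there p

at-< : At xs i z → i < length xs
at-< here = z<s
at-< (there p) = s<s (at-< p)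

at-length : ∀ (xs : List A) {ys} → At (xs ++ z ∷ ys) (length xs) z
at-length [] = here
at-length (_ ∷ xs) = there (at-length xs)

at-split : At xs i z → ∃[ p ] ∃[ q ] (xs ≡ p ++ z ∷ q × length p ≡ i)
at-split here = [] , _ , refl , refl
at-split (there {z' = z'} m) =
  let p , q , eq , len = at-split m in z' ∷ p , q , cong (z' ∷_) eq , cong suc len

at-prefix : ∀ (p : List A) {q} → At (p ++ q) i z → i < length p → z ∈ p
at-prefix (_ ∷ _) here _ = here refl
at-prefix (_ ∷ p) (there m) (s≤s lt) = there (at-prefix p m lt)

∈-prefix : ∀ {p q : List A} → z ∈ p → ∃[ i ] (i < length p × At (p ++ q) i z)
∈-prefix (here refl) = 0 , z<s , here
∈-prefix (there m) = let i , lt , p = ∈-prefix m in suc i , s<s lt , there p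

before-∷ : ∀ {a b} → Before xs a b → Before (z ∷ xs) a b
before-∷ (p , q , r , refl) = _ ∷ p , q , r , refl

before-head : z' ∈ xs → Before (z ∷ xs) z z'
before-head m = let q , r , eq = ∈-∃++ m in [] , q , r , cong (_ ∷_) eq

at⇒before : At xs i z → At xs j z' → i < j → Before xs z z'
at⇒before here (there q) _ = before-head (at⇒∈ q)
at⇒before (there p) (there q) (s≤s lt) = before-∷ (at⇒before p q lt)

before⇒at : ∀ {a b} → Before xs a b → ∃[ i ] ∃[ j ] (i < j × At xs i a × At xs j b)
before⇒at {a = a} {b} (p , q , r , refl) = length p , length (p ++ a ∷ q) , lt , at-length p , at-b
  where
  lt : length p < length (p ++ a ∷ q)
  lt = subst (length p <_) (sym (length-++ p)) (m<m+n (length p) z<s)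
  at-b : At (p ++ a ∷ q ++ b ∷ r) (length (p ++ a ∷ q)) b
  at-b = subst (λ zs → At zs (length (p ++ a ∷ q)) b) (++-assoc p (a ∷ q) _) (at-length (p ++ a ∷ q))

split⇒before : ∀ {p q : List A} → z' ∈ p → Before (p ++ z ∷ q) z' z
split⇒before (here refl) = before-head (∈-insert _)
split⇒before (there m) = before-∷ (split⇒before m)

module _ {A : Set} {xs : List A} (uniq : Unique xs) where

  at-injective : ∀ {x i j} → At xs i x → At xs j x → i ≡ j
  at-injective = go uniq
    where
    go : ∀ {zs x i j} → Unique zs → At zs i x → At zs j x → i ≡ j
    go _ here here = refl
    go (n ∷ _) here (there q) = ⊥-elim (All.lookup n (at⇒∈ q) refl)
    go (n ∷ _) (there p) here = ⊥-elim (All.lookup n (at⇒∈ p) refl)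
    go (_ ∷ u) (there p) (there q) = cong suc (go u p q)

  before-trans : ∀ {a b c} → Before xs a b → Before xs b c → Before xs a c
  before-trans ab bc with before⇒at ab | before⇒at bc
  ... | i , j , i<j , p , q | j' , k , j<k , q' , r with refl ← at-injective q q' =
    at⇒before p r (<-trans i<j j<k)

  before-irrefl : ∀ {a} → ¬ Before xs a a
  before-irrefl aa with i , j , i<j , p , q ← before⇒at aa = <⇒≢ i<j (at-injective p q)

  before-asym : ∀ {a b} → Before xs a b → ¬ Before xs b a
  before-asym ab ba = before-irrefl (before-trans ab ba)

  before⇒∈-prefix : ∀ {a b} p {q} → xs ≡ p ++ b ∷ q → Before xs a b → a ∈ p
  before⇒∈-prefix p refl ab with i , j , i<j , at-a , at-b ← before⇒at ab
    with refl ← at-injective at-b (at-length p) = at-prefix p at-a i<j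

-- Positions of invocations and responses in well-formed histories.

module WellFormed {h : History} (wf : WF h) where
  open WF wf

  inv-injective : ∀ {i j u o o'} → At h i (inv u o) → At h j (inv u o') → i ≡ j
  inv-injective {i} {j} p q with <-cmp i j
  ... | tri≈ _ eq _ = eq
  ... | tri< lt _ _ = let _ , _ , _ , eq = at⇒before p q lt in ⊥-elim (inv-once _ _ _ _ _ _ eq)
  ... | tri> _ _ gt = let _ , _ , _ , eq = at⇒before q p gt in ⊥-elim (inv-once _ _ _ _ _ _ eq)

  res-injective : ∀ {i j u t t'} → At h i (res u t) → At h j (res u t') → i ≡ j
  res-injective {i} {j} p q with <-cmp i j
  ... | tri≈ _ eq _ = eq
  ... | tri< lt _ _ = let _ , _ , _ , eq = at⇒before p q lt in ⊥-elim (res-once _ _ _ _ _ _ eq)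
  ... | tri> _ _ gt = let _ , _ , _ , eq = at⇒before q p gt in ⊥-elim (res-once _ _ _ _ _ _ eq)

  inv-op-unique : ∀ {u o o'} → inv u o ∈ h → inv u o' ∈ h → o ≡ o'
  inv-op-unique m n with ∈⇒at m | ∈⇒at n
  ... | i , p | j , q with refl ← inv-injective p q with refl ← at-functional p q = refl

  res-inv : ∀ {r u t} → At h r (res u t) → ∃[ i ] ∃[ o ] (i < r × At h i (inv u o) × Matches o t)
  res-inv p with at-split p
  ... | pre , post , refl , refl with res-after-inv pre _ _ post refl
  ... | o , m , match with i , lt , q ← ∈-prefix m = i , o , lt , q , match

  inv<res : ∀ {i r u o t} → At h i (inv u o) → At h r (res u t) → i < r
  inv<res p q with j , _ , lt , q' , _ ← res-inv q with refl ← inv-injective p q' = lt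

  matches : ∀ {u o t} → inv u o ∈ h → res u t ∈ h → Matches o t
  matches m n with _ , _ , _ , q , match ← res-inv (proj₂ (∈⇒at n))
    with refl ← inv-op-unique m (at⇒∈ q) = match

  prec⇒< : ∀ {u v t o r i} → Prec h u v → At h r (res u t) → At h i (inv v o) → r < i
  prec⇒< (_ , _ , bef) p q with r' , i' , lt , p' , q' ← before⇒at bef
    with refl ← res-injective p p' with refl ← inv-injective q q' = lt

  <⇒prec : ∀ {u v t o r i} → At h r (res u t) → At h i (inv v o) → r < i → Prec h u v
  <⇒prec p q lt = _ , _ , at⇒before p q lt

  module _ (complete : Complete h) where

    enq-event : ∀ {u x} → inv u (enq x) ∈ h → EventOf h (u , enqL x)
    enq-event m with t , n ← complete _ _ m with enq-ok _ ← matches m n = m , n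

-- Pending events and completions.

isResOf-sound : ∀ u a → T (isResOf u a) → ∃[ t ] (a ≡ res u t)
isResOf-sound u (res v t) p = t , cong (λ w → res w t) (sym (≡ᵇ⇒≡ u v p))

∈⇒any-isResOf : ∀ {h u t} → res u t ∈ h → T (any (isResOf u) h)
∈⇒any-isResOf {u = u} m = any⁺ _ (Any.map (λ { refl → ≡⇒≡ᵇ u u refl }) m)

any-isResOf⇒∈ : ∀ h u → T (any (isResOf u) h) → ∃[ t ] (res u t ∈ h)
any-isResOf⇒∈ h u p = go (any⁻ _ h p)
  where
  go : ∀ {zs} → Any (T ∘ isResOf u) zs → ∃[ t ] (res u t ∈ zs)
  go (here {x = a} q) with t , refl ← isResOf-sound u a q = t , here refl
  go (there m) = let t , n = go m in t , there n

-- The response that lets an invocation pass the filter has the same identifier, so it passes the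
-- same test and is kept too.
dropPending-complete : ∀ h → Complete (dropPending h)
dropPending-complete h u o m
  with _ , p ← ∈-filter⁻ (λ a → T? (any (isResOf (idOf a)) h)) {xs = h} m
  with t , n ← any-isResOf⇒∈ h u p = t , ∈-filter⁺ (λ a → T? (any (isResOf (idOf a)) h)) n p

-- An appended response would answer an invocation of `c`, which already has a response there,
-- against `res-once`. So nothing is appended, and with no event pending the filter drops nothing.
completion-of-complete : ∀ {c ĉ} → Complete c → Compl c ĉ → ĉ ≡ c
completion-of-complete {c} complete ([] , _ , _ , refl) rewrite ++-identityʳ c =
  filter-all _ (All.tabulate responded)
  where
  responded : ∀ {a} → a ∈ c → T (any (isResOf (idOf a)) c)
  responded {inv u o} m = ∈⇒any-isResOf (proj₂ (complete u o m))
  responded {res u t} m = ∈⇒any-isResOf m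
completion-of-complete {c} complete (res u t ∷ c' , _ , wf , _)
  with o , m , _ ← WF.res-after-inv wf c u t c' refl
  with t' , n ← complete u o m
  with p , q , refl ← ∈-∃++ n = ⊥-elim (WF.res-once wf p q c' u t' t (++-assoc p _ _))
completion-of-complete complete (inv u o ∷ c' , () ∷ _ , _ , _)

-- Enqueued and dequeued values along runs of the queue.

enqs : List Label → List ℕ
enqs [] = []
enqs (enqL x ∷ ls) = x ∷ enqs ls
enqs (deqL _ ∷ ls) = enqs ls

deqs : List Label → List ℕ
deqs [] = []
deqs (enqL _ ∷ ls) = deqs ls
deqs (deqL (just x) ∷ ls) = x ∷ deqs ls
deqs (deqL nothing ∷ ls) = deqs ls

enqs-++ : ∀ ls {ls'} → enqs (ls ++ ls') ≡ enqs ls ++ enqs ls'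
enqs-++ [] = refl
enqs-++ (enqL x ∷ ls) = cong (x ∷_) (enqs-++ ls)
enqs-++ (deqL _ ∷ ls) = enqs-++ ls

-- The FIFO invariant. The initial contents `q` are arbitrary because they change along the run: an
-- enqueue only reassociates `++`, and a dequeue strips the same head from both sides.
run-fifo : ∀ ls {ls' q} → Run q (ls ++ ls') →
           ∃[ q' ] (q ++ enqs ls ≡ deqs ls ++ q' × Run q' ls')
run-fifo [] r = _ , ++-identityʳ _ , r
run-fifo (enqL x ∷ ls) (step (enqS q x) r) with q' , eq , r' ← run-fifo ls r =
  q' , trans (sym (++-assoc q (x ∷ []) _)) eq , r'
run-fifo (deqL (just x) ∷ ls) (step (deqS x q) r) with q' , eq , r' ← run-fifo ls r =
  q' , cong (x ∷_) eq , r'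
run-fifo (deqL nothing ∷ ls) (step nullS r) = run-fifo ls r

labels : List Event → List Label
labels = map proj₂

∈-enqs⁺ : ∀ {s u x} → (u , enqL x) ∈ s → x ∈ enqs (labels s)
∈-enqs⁺ (here refl) = here refl
∈-enqs⁺ {(_ , enqL _) ∷ _} (there m) = there (∈-enqs⁺ m)
∈-enqs⁺ {(_ , deqL _) ∷ _} (there m) = ∈-enqs⁺ m

∈-enqs⁻ : ∀ {x} s → x ∈ enqs (labels s) → ∃[ u ] ((u , enqL x) ∈ s)
∈-enqs⁻ ((u , enqL x) ∷ s) (here refl) = u , here refl
∈-enqs⁻ ((_ , enqL _) ∷ s) (there m) = let u , n = ∈-enqs⁻ s m in u , there n
∈-enqs⁻ ((_ , deqL _) ∷ s) m = let u , n = ∈-enqs⁻ s m in u , there n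

∈-deqs⁺ : ∀ {s u x} → (u , deqL (just x)) ∈ s → x ∈ deqs (labels s)
∈-deqs⁺ (here refl) = here refl
∈-deqs⁺ {(_ , enqL _) ∷ _} (there m) = ∈-deqs⁺ m
∈-deqs⁺ {(_ , deqL (just _)) ∷ _} (there m) = there (∈-deqs⁺ m)
∈-deqs⁺ {(_ , deqL nothing) ∷ _} (there m) = ∈-deqs⁺ m

∈-deqs⁻ : ∀ {x} s → x ∈ deqs (labels s) → ∃[ u ] ((u , deqL (just x)) ∈ s)
∈-deqs⁻ ((_ , enqL _) ∷ s) m = let u , n = ∈-deqs⁻ s m in u , there n
∈-deqs⁻ ((u , deqL (just x)) ∷ s) (here refl) = u , here refl
∈-deqs⁻ ((_ , deqL (just _)) ∷ s) (there m) = let u , n = ∈-deqs⁻ s m in u , there n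
∈-deqs⁻ ((_ , deqL nothing) ∷ s) m = let u , n = ∈-deqs⁻ s m in u , there n

enqs-unique : ∀ {s} → Unique s →
              (∀ {u u' x} → (u , enqL x) ∈ s → (u' , enqL x) ∈ s → u ≡ u') →
              Unique (enqs (labels s))
enqs-unique [] _ = []
enqs-unique {(u , enqL x) ∷ s} (n ∷ uniq) once =
  All.tabulate fresh ∷ enqs-unique uniq (λ p q → once (there p) (there q))
  where
  fresh : ∀ {y} → y ∈ enqs (labels s) → x ≢ y
  fresh m refl with u' , m' ← ∈-enqs⁻ s m with refl ← once (here refl) (there m') =
    All.lookup n m' refl
enqs-unique {(u , deqL _) ∷ s} (_ ∷ uniq) once =
  enqs-unique uniq (λ p q → once (there p) (there q))

deqs-unique⇒injective : ∀ {s d d' x} → Unique (deqs (labels s)) →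
                        (d , deqL (just x)) ∈ s → (d' , deqL (just x)) ∈ s → d ≡ d'
deqs-unique⇒injective _ (here refl) (here refl) = refl
deqs-unique⇒injective (n ∷ _) (here refl) (there q) = ⊥-elim (All.lookup n (∈-deqs⁺ q) refl)
deqs-unique⇒injective (n ∷ _) (there p) (here refl) = ⊥-elim (All.lookup n (∈-deqs⁺ p) refl)
deqs-unique⇒injective {(_ , enqL _) ∷ _} uniq (there p) (there q) = deqs-unique⇒injective uniq p q
deqs-unique⇒injective {(_ , deqL (just _)) ∷ _} (_ ∷ uniq) (there p) (there q) =
  deqs-unique⇒injective uniq p q
deqs-unique⇒injective {(_ , deqL nothing) ∷ _} uniq (there p) (there q) =
  deqs-unique⇒injective uniq p q

before-enqs : ∀ {s u v x y} → Before s (u , enqL x) (v , enqL y) → Before (enqs (labels s)) x y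
before-enqs {u = u} {v} {x} {y} (p , q , r , refl) =
  enqs (labels p) , enqs (labels q) , enqs (labels r) , (begin
    enqs (labels (p ++ (u , enqL x) ∷ q ++ (v , enqL y) ∷ r))
      ≡⟨ cong enqs (map-++ proj₂ p _) ⟩
    enqs (labels p ++ enqL x ∷ labels (q ++ (v , enqL y) ∷ r))
      ≡⟨ enqs-++ (labels p) ⟩
    enqs (labels p) ++ x ∷ enqs (labels (q ++ (v , enqL y) ∷ r))
      ≡⟨ cong (λ zs → enqs (labels p) ++ x ∷ enqs zs) (map-++ proj₂ q _) ⟩
    enqs (labels p) ++ x ∷ enqs (labels q ++ enqL y ∷ labels r)
      ≡⟨ cong (λ zs → enqs (labels p) ++ x ∷ zs) (enqs-++ (labels q)) ⟩
    enqs (labels p) ++ x ∷ enqs (labels q) ++ y ∷ enqs (labels r) ∎)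
  where open ≡-Reasoning

-- The maximum of the chosen positions, starting from `i`. The element attaining it is returned as
-- well, because the argument about NULL dequeues needs an actual invocation at `p`.
latest : ∀ {A : Set} {Q : A → ℕ → Set} {r} {b i} (zs : List A) → Q b i → i < r →
         (∀ {e} → e ∈ zs → ∃[ j ] (Q e j × j < r)) →
         ∃[ p ] (i ≤ p × p < r × (∃[ e ] (e ∈ b ∷ zs × Q e p)) ×
                 (∀ {e} → e ∈ zs → ∃[ j ] (Q e j × j ≤ p)))
latest [] qb i<r _ = _ , ≤-refl , i<r , (_ , here refl , qb) , λ ()
latest (z ∷ zs) qb i<r bound
  with p , i≤p , p<r , (e , m , qe) , below ← latest zs qb i<r (bound ∘ there)
  with j , qz , j<r ← bound (here refl)
  with ≤-total j p
... | inj₁ j≤p = p , i≤p , p<r , (e , weaken m , qe) ,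
                 λ { (here refl) → j , qz , j≤p ; (there m') → below m' }
  where
  weaken : ∀ {e b} → e ∈ b ∷ zs → e ∈ b ∷ z ∷ zs
  weaken (here eq) = here eq
  weaken (there n) = there (there n)
... | inj₂ p≤j = j , ≤-trans i≤p p≤j , j<r , (z , there (here refl) , qz) ,
                 λ { (here refl) → j , qz , ≤-refl
                   ; (there m') → let k , qk , k≤p = below m' in k , qk , ≤-trans k≤p p≤j }

-- Converts a position inside the interval of an operation into a split of `cd` as in `VWit`. The
-- new prefix holds the positions up to and including `p`, hence the length `suc p`.
window : ∀ {A : Set} {a b : A} c₀ cd c₃ {p} → length c₀ ≤ p → p < length (c₀ ++ a ∷ cd) →
         ∃[ c₁ ] ∃[ c₂ ] ∃[ rest ] (cd ≡ c₁ ++ c₂ ×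
           c₀ ++ a ∷ cd ++ b ∷ c₃ ≡ (c₀ ++ a ∷ c₁) ++ rest ×
           length (c₀ ++ a ∷ c₁) ≡ suc p)
window {a = a} {b} c₀ cd c₃ {p} lo hi =
  take n cd , drop n cd , drop n cd ++ b ∷ c₃ , sym (take++drop≡id n cd) ,
  sym (trans (++-assoc c₀ _ _) (cong (λ zs → c₀ ++ a ∷ zs)
    (trans (sym (++-assoc (take n cd) (drop n cd) _)) (cong (_++ b ∷ c₃) (take++drop≡id n cd))))) ,
  (begin
    length (c₀ ++ a ∷ take n cd)         ≡⟨ length-++ c₀ ⟩
    length c₀ + suc (length (take n cd)) ≡⟨ +-suc (length c₀) _ ⟩
    suc (length c₀ + length (take n cd)) ≡⟨ cong (λ k → suc (length c₀ + k)) (length-take n cd) ⟩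
    suc (length c₀ + n ⊓ length cd)      ≡⟨ cong (λ k → suc (length c₀ + k)) (m≤n⇒m⊓n≡m n≤) ⟩
    suc (length c₀ + n)                  ≡⟨ cong suc (m+[n∸m]≡n lo) ⟩
    suc p ∎)
  where
  open ≡-Reasoning
  -- The action `a` occupies position `length c₀`, so this many actions of `cd` extend the prefix
  -- through position `p`.
  n = p ∸ length c₀
  n≤ : n ≤ length cd
  n≤ = m≤n+o⇒m∸n≤o p (length c₀)
    (s≤s⁻¹ (subst (suc p ≤_) (trans (length-++ c₀) (+-suc (length c₀) (length cd))) hi))

-- Legal orderings exclude violations.

module Soundness {h : History} (wf : WF h) (complete : Complete h) (once : EnqOnce h)
                 {s : List Event} (ordering : LegalOrdering h s) where
  open WellFormed wf

  sound : ∀ {e} → e ∈ s → EventOf h e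
  sound = proj₁ ordering _

  covers : ∀ {e} → EventOf h e → e ∈ s
  covers = proj₁ (proj₂ ordering) _

  uniq : Unique s
  uniq = proj₁ (proj₂ (proj₂ ordering))

  run : Run [] (labels s)
  run = proj₁ (proj₂ (proj₂ (proj₂ ordering)))

  event-inv : ∀ {e} → EventOf h e → ∃[ o ] ∃[ i ] At h i (inv (proj₁ e) o)
  event-inv {u , enqL x} (m , _) = enq x , ∈⇒at m
  event-inv {u , deqL _} (m , _) = deq , ∈⇒at m

  prec⇒before : ∀ {e e'} → e ∈ s → e' ∈ s → Prec h (proj₁ e) (proj₁ e') → Before s e e'
  prec⇒before = proj₂ (proj₂ (proj₂ (proj₂ ordering))) _ _

  fifo : ∀ p {q} → s ≡ p ++ q →
         ∃[ c ] (enqs (labels p) ≡ deqs (labels p) ++ c × Run c (labels q))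
  fifo p refl = run-fifo (labels p) (subst (Run []) (map-++ proj₂ p _) run)

  unique-enqs : Unique (enqs (labels s))
  unique-enqs = enqs-unique uniq λ {u} {u'} {x} m n →
    once u u' x (proj₁ (sound m)) (proj₁ (sound n))

  -- Applied to all of `s`, the invariant makes the dequeued values a prefix of the enqueued ones,
  -- which are pairwise distinct.
  unique-deqs : Unique (deqs (labels s))
  unique-deqs with c , eq , _ ← fifo s (sym (++-identityʳ s)) =
    ++-uniqueˡ (subst Unique eq unique-enqs)
    where
    ++-uniqueˡ : ∀ {xs ys : List ℕ} → Unique (xs ++ ys) → Unique xs
    ++-uniqueˡ {[]} _ = []
    ++-uniqueˡ {_ ∷ xs} (n ∷ u) =
      All.tabulate (λ m → All.lookup n (∈-++⁺ˡ m)) ∷ ++-uniqueˡ u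

  -- A dequeue of `x` can only step when `x` heads the queue, so the invariant for the events before
  -- it puts `x` among the values they enqueue.
  enq-before-deq : ∀ {d x} → (d , deqL (just x)) ∈ s →
                   ∃[ u ] Before s (u , enqL x) (d , deqL (just x))
  enq-before-deq m with p , q , refl ← ∈-∃++ m with fifo p refl
  ... | _ , eq , step (deqS x _) _
    with u , n ← ∈-enqs⁻ p (subst (x ∈_) (sym eq) (∈-++⁺ʳ (deqs (labels p)) (here refl))) =
    u , split⇒before n

  -- When `x` heads the queue, the values dequeued so far are exactly those enqueued ahead of `x`,
  -- and `y` is one of them.
  deqs-fifo : ∀ {ex ey dx x y} → Before s (ey , enqL y) (ex , enqL x) →
              (dx , deqL (just x)) ∈ s → ∃[ dy ] Before s (dy , deqL (just y)) (dx , deqL (just x))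
  deqs-fifo {dx = dx} {x} {y} bef m with p , q , refl ← ∈-∃++ m with fifo p refl
  ... | c , eq , step (deqS x c') _ = dy , split⇒before n
    where
    whole : enqs (labels s) ≡ deqs (labels p) ++ x ∷ c' ++ enqs (labels ((dx , deqL (just x)) ∷ q))
    whole = trans (cong enqs (map-++ proj₂ p _))
      (trans (enqs-++ (labels p)) (trans (cong (_++ _) eq) (++-assoc (deqs (labels p)) _ _)))
    found : ∃[ dy ] ((dy , deqL (just y)) ∈ p)
    -- Distinctness of the enqueued values ensures that this occurrence of `x` is the one that
    -- follows `y`.
    found = ∈-deqs⁻ p (before⇒∈-prefix unique-enqs (deqs (labels p)) whole (before-enqs bef))
    dy = proj₁ found
    n = proj₂ found

  before⇒∈ˡ : ∀ {a b : Event} → Before s a b → a ∈ s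
  before⇒∈ˡ (p , _ , _ , eq) = subst (_ ∈_) (sym eq) (∈-insert p)

  deq-injective : ∀ {d d' x} → (d , deqL (just x)) ∈ s → (d' , deqL (just x)) ∈ s → d ≡ d'
  deq-injective = deqs-unique⇒injective unique-deqs

  ¬fresh : ¬ VFresh h
  ¬fresh (x , d , deq-x , bad) with u , bef ← enq-before-deq (covers deq-x) | bad
  ... | inj₁ none = none u (proj₁ (sound (before⇒∈ˡ bef)))
  ... | inj₂ (u' , enq-x , prec)
    with refl ← once _ _ _ enq-x (proj₁ (sound (before⇒∈ˡ bef))) =
    before-asym uniq bef (prec⇒before (covers deq-x) (before⇒∈ˡ bef) prec)

  ¬repet : ¬ VRepet h
  ¬repet (d , d' , x , d≢d' , p , q) = d≢d' (deq-injective (covers p) (covers q))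

  ¬ord : ¬ VOrd h
  ¬ord (x , y , ex , ey , dx , enq-x , enq-y , prec , deq-x , bad)
    with dy , bef ← deqs-fifo (prec⇒before (covers (enq-event complete enq-y))
                                           (covers (enq-event complete enq-x)) prec)
                              (covers deq-x)
    with bad
  ... | inj₁ none = none dy (sound (before⇒∈ˡ bef))
  ... | inj₂ (dy' , deq-y , prec')
    with refl ← deq-injective (before⇒∈ˡ bef) (covers deq-y) =
    before-asym uniq bef (prec⇒before (covers deq-x) (covers deq-y) prec')

  -- The empty moment of a NULL dequeue.

  module _ {d c₀ cd c₃} (h≡ : h ≡ c₀ ++ inv d deq ∷ cd ++ res d (ret nothing) ∷ c₃) where
    private
      dᴱ : Event
      dᴱ = d , deqL nothing

      r : ℕ
      r = length (c₀ ++ inv d deq ∷ cd)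

      at-inv : At h (length c₀) (inv d deq)
      at-inv = subst (λ zs → At zs _ _) (sym h≡) (at-length c₀)

      at-res : At h r (res d (ret nothing))
      at-res = subst (λ zs → At zs r _) (trans (++-assoc c₀ _ _) (sym h≡))
                     (at-length (c₀ ++ inv d deq ∷ cd))

      d∈s : dᴱ ∈ s
      d∈s = covers (at⇒∈ at-inv , at⇒∈ at-res)

      InvAt : Event → ℕ → Set
      InvAt e i = ∃[ o ] At h i (inv (proj₁ e) o)

    module _ {s₁ s₂} (s≡ : s ≡ s₁ ++ dᴱ ∷ s₂) (drained : enqs (labels s₁) ≡ deqs (labels s₁)) where
      private
        before-d : ∀ {e} → e ∈ s₁ → Before s e dᴱ
        before-d m = subst (λ zs → Before zs _ _) (sym s≡) (split⇒before m)

        -- An invocation after the response of `d` would force `d` before `e` in `s`, and position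
        -- `r` itself holds a response.
        early : ∀ {e} → e ∈ s₁ → ∃[ j ] (InvAt e j × j < r)
        early m with event-inv (sound (before⇒∈ˡ (before-d m)))
        ... | o , j , q with <-cmp j r
        ... | tri< j<r _ _ = j , (o , q) , j<r
        ... | tri≈ _ refl _ with () ← at-functional q at-res
        ... | tri> _ _ r<j = ⊥-elim (before-asym uniq (before-d m)
          (prec⇒before d∈s (before⇒∈ˡ (before-d m)) (<⇒prec at-res q r<j)))

        -- Otherwise the enqueue would follow `d` in `s`, and hence follow `e`, which is `d` or
        -- comes before it. Yet its response precedes the invocation of `e` at `p`, strictly because
        -- one position holds one action.
        linearized-before : ∀ {u x e k p} → (u , enqL x) ∈ s → At h k (res u ok) → k ≤ p →
                            e ∈ dᴱ ∷ s₁ → InvAt e p → (u , enqL x) ∈ s₁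
        linearized-before {u} {x} {e} {k} {p} u∈s at-k k≤p e∈ (o , at-p)
          with ∈-++⁻ s₁ (subst (_ ∈_) s≡ u∈s)
        ... | inj₁ m = m
        ... | inj₂ (there m) = ⊥-elim (absurd e∈)
          where
          k<p : k < p
          k<p = ≤∧≢⇒< k≤p k≢p
            where
            k≢p : k ≢ p
            k≢p refl with () ← at-functional at-k at-p
          d-before-u : Before s dᴱ (u , enqL x)
          d-before-u with q , r' , eq ← ∈-∃++ m = s₁ , q , r' , trans s≡ (cong (λ zs → s₁ ++ dᴱ ∷ zs) eq)
          absurd : e ∈ dᴱ ∷ s₁ → ⊥
          absurd (here refl) = before-asym uniq d-before-u (prec⇒before u∈s d∈s (<⇒prec at-k at-p k<p))
          absurd (there n) = before-asym uniq (before-trans uniq (before-d n) d-before-u)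
            (prec⇒before u∈s (before⇒∈ˡ (before-d n)) (<⇒prec at-k at-p k<p))

      -- The last invocation among d and the events linearized before d is a moment, inside the
      -- interval of d, at which every completed enqueue is already linearized before d, so
      -- that its value has been dequeued by an event invoked by then.
      ∃-uncovered-split : ∃[ c₁ ] ∃[ c₂ ] (cd ≡ c₁ ++ c₂ ×
        (∀ {u x} → inv u (enq x) ∈ c₀ ++ inv d deq ∷ c₁ → res u ok ∈ c₀ ++ inv d deq ∷ c₁ →
          ∃[ w ] (inv w deq ∈ c₀ ++ inv d deq ∷ c₁ × res w (ret (just x)) ∈ h)))
      ∃-uncovered-split
        with p , lo , hi , (e , e∈ , inv-e) , below ←
               latest {Q = InvAt} s₁ (deq , at-inv) (inv<res at-inv at-res) early
        with c₁ , c₂ , rest , cd≡ , h≡' , len ←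
               window {a = inv d deq} {res d (ret nothing)} c₀ cd c₃ lo hi =
        c₁ , c₂ , cd≡ , dequeued
        where
        prefix = c₀ ++ inv d deq ∷ c₁
        in-h : ∀ {a} → a ∈ prefix → ∃[ i ] (i ≤ p × At h i a)
        in-h m with i , lt , q ← ∈-prefix {q = rest} m =
          i , s≤s⁻¹ (subst (i <_) len lt) , subst (λ zs → At zs i _) (sym (trans h≡ h≡')) q
        in-prefix : ∀ {i a} → At h i a → i ≤ p → a ∈ prefix
        in-prefix {i} q i≤p = at-prefix prefix (subst (λ zs → At zs i _) (trans h≡ h≡') q)
                                (subst (i <_) (sym len) (s≤s i≤p))
        dequeued : ∀ {u x} → inv u (enq x) ∈ prefix → res u ok ∈ prefix →
                   ∃[ w ] (inv w deq ∈ prefix × res w (ret (just x)) ∈ h)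
        dequeued {u} {x} inv-u res-u
          with i , _ , at-i ← in-h inv-u
          with k , k≤p , at-k ← in-h res-u
          with u∈s₁ ← linearized-before (covers (at⇒∈ at-i , at⇒∈ at-k)) at-k k≤p e∈ inv-e
          with w , w∈s₁ ← ∈-deqs⁻ s₁ (subst (x ∈_) drained (∈-enqs⁺ u∈s₁))
          with inv-w , res-w ← sound (before⇒∈ˡ (before-d w∈s₁))
          with j , (_ , at-j) , j≤p ← below w∈s₁
          with refl ← inv-op-unique inv-w (at⇒∈ at-j) = w , in-prefix at-j j≤p , res-w

    null-uncovered : ∃[ c₁ ] ∃[ c₂ ] (cd ≡ c₁ ++ c₂ ×
      (∀ {u x} → inv u (enq x) ∈ c₀ ++ inv d deq ∷ c₁ → res u ok ∈ c₀ ++ inv d deq ∷ c₁ →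
        ∃[ w ] (inv w deq ∈ c₀ ++ inv d deq ∷ c₁ × res w (ret (just x)) ∈ h)))
    null-uncovered with s₁ , s₂ , s≡ ← ∈-∃++ d∈s with fifo s₁ s≡
    -- `nullS` forces empty contents, so by the invariant the events before `d` dequeue all that
    -- they enqueue.
    ... | _ , eq , step nullS _ = ∃-uncovered-split s≡ (trans eq (++-identityʳ _))

  ¬wit : ¬ VWit h
  ¬wit (d , c₀ , cd , c₃ , h≡ , covered)
    with c₁ , c₂ , cd≡ , dequeued ← null-uncovered h≡
    with x , u , inv-u , res-u , undequeued ← covered c₁ c₂ cd≡
    with w , inv-w , res-w ← dequeued inv-u res-u =
    undequeued w (just x) inv-w res-w refl

  ¬violation : ¬ Violation h
  ¬violation (inj₁ v) = ¬fresh v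
  ¬violation (inj₂ (inj₁ v)) = ¬repet v
  ¬violation (inj₂ (inj₂ (inj₁ v))) = ¬ord v
  ¬violation (inj₂ (inj₂ (inj₂ v))) = ¬wit v

-- Common linear extensions of two interval orders.

module IntervalOrder {A : Set} (a b c d : A → ℕ)
                     (a≤b : ∀ x → a x ≤ b x) (c≤d : ∀ x → c x ≤ d x) where

  NonConflicting : List A → Set
  NonConflicting xs = ∀ {x y} → x ∈ xs → y ∈ xs → b x < a y → ¬ (d y < c x)

  -- Means that `x` may be listed first: `y` precedes `x` in neither interval order. This is not
  -- transitive in general, so a sorted list has to satisfy it for all pairs.
  _⊑_ : A → A → Set
  x ⊑ y = a x ≤ b y × c x ≤ d y

  argmin-∈ : ∀ (f : A → ℕ) z zs → argmin f z zs ∈ z ∷ zs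
  argmin-∈ f z zs with argmin-sel f z zs
  ... | inj₁ eq = here eq
  ... | inj₂ m = there m

  argmin-≤ : ∀ (f : A → ℕ) z zs {y} → y ∈ z ∷ zs → f (argmin f z zs) ≤ f y
  argmin-≤ f z zs (here refl) = f[argmin]≤f[⊤] {f = f} z zs
  argmin-≤ f z zs (there m) = All.lookup (f[argmin]≤f[xs] {f = f} z zs) m

  -- If `y` starts by `b w`, the choice of `m` gives `c m ≤ c y`. If it starts later, `w` precedes
  -- `y` in the first order, so the absence of conflicts gives `c w ≤ d y`, and `c m ≤ c w`.
  minimum : ∀ z zs → NonConflicting (z ∷ zs) → ∃[ m ] (m ∈ z ∷ zs × (∀ {y} → y ∈ z ∷ zs → m ⊑ y))
  minimum z zs nc = m , m∈ , λ y∈ → ≤-trans am≤bw (argmin-≤ b z zs y∈) , below y∈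
    where
    w = argmin b z zs
    w∈ = argmin-∈ b z zs
    early? = λ x → a x ≤? b w
    early = filter early? (z ∷ zs)
    -- The default `w` is itself early, by `a≤b`; passing it here also gives `c m ≤ c w`.
    m = argmin c w early
    m-early : m ∈ z ∷ zs × a m ≤ b w
    m-early with argmin-∈ c w early
    ... | here eq = subst (λ x → x ∈ z ∷ zs × a x ≤ b w) (sym eq) (w∈ , a≤b w)
    ... | there n = ∈-filter⁻ early? {xs = z ∷ zs} n
    m∈ = proj₁ m-early
    am≤bw = proj₂ m-early
    below : ∀ {y} → y ∈ z ∷ zs → c m ≤ d y
    below {y} y∈ with a y ≤? b w
    ... | yes ay≤bw = ≤-trans (argmin-≤ c w early (there (∈-filter⁺ early? y∈ ay≤bw))) (c≤d y)
    ... | no ay≰bw = ≤-trans (argmin-≤ c w early (here refl))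
                             (≮⇒≥ (nc w∈ y∈ (≰⇒> ay≰bw)))

  -- Extracts a common minimum and continues with the rest, which stays free of conflicts. The
  -- recursion is on the length because the minimum may sit anywhere in the list.
  order : ∀ xs → NonConflicting xs → ∃[ ys ] (ys ↭ xs × AllPairs _⊑_ ys)
  order xs = go (length xs) xs refl
    where
    go : ∀ n xs → length xs ≡ n → NonConflicting xs → ∃[ ys ] (ys ↭ xs × AllPairs _⊑_ ys)
    go zero [] _ _ = [] , ↭-refl , []
    go (suc n) (z ∷ zs) len nc with m , m∈ , below ← minimum z zs nc with p , q , eq ← ∈-∃++ m∈ =
      m ∷ ys , ↭-trans (prep m perm) (↭-sym z∷zs↭) ,
      All-resp-↭ (↭-sym perm) (All.tabulate (below ∘ back ∘ there)) ∷ sorted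
      where
      z∷zs↭ : z ∷ zs ↭ m ∷ p ++ q
      z∷zs↭ = ↭-trans (↭-reflexive eq) (shift m p q)
      back : ∀ {x} → x ∈ m ∷ p ++ q → x ∈ z ∷ zs
      back = ∈-resp-↭ (↭-sym z∷zs↭)
      len' : length (p ++ q) ≡ n
      len' = suc-injective (trans (sym (↭-length z∷zs↭)) len)
      rec = go n (p ++ q) len' (λ x∈ y∈ → nc (back (there x∈)) (back (there y∈)))
      ys = proj₁ rec
      perm = proj₁ (proj₂ rec)
      sorted = proj₂ (proj₂ rec)

-- Merging enqueues and dequeues into a run of the queue.

data Kind : Set where
  value : (u x w : ℕ) → Kind
  null  : (d : ℕ) → Kind

-- The times chosen for one element. In a kind `value u x w`, the events `u` and `w` enqueue and
-- dequeue `x`.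
record Slot : Set where
  constructor slot
  field
    kind  : Kind
    enter leave : ℕ
open Slot

_≼_ : Slot → Slot → Set
s ≼ t = enter s ≤ enter t × leave s ≤ leave t

-- A NULL slot is a single instant: in a sorted list all slots before it leave no later and all
-- slots after it enter no earlier, so the queue can be empty then.
data Proper : Slot → Set where
  value : ∀ {u x w e f} → e ≤ f → Proper (slot (value u x w) e f)
  null  : ∀ {d e} → Proper (slot (null d) e e)

proper⇒≤ : ∀ {s} → Proper s → enter s ≤ leave s
proper⇒≤ (value e≤f) = e≤f
proper⇒≤ null = ≤-refl

data IsValue : Slot → Set where
  value : ∀ {u x w e f} → IsValue (slot (value u x w) e f)

-- The `0` is a filler, since the merge only puts slots satisfying `IsValue` into the queue.
content : Slot → ℕ
content (slot (value _ x _) _ _) = x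
content (slot (null _) _ _) = 0

Timed : Set
Timed = ℕ × Event

entering : Slot → List Timed
entering (slot (value u x _) e _) = [ (e , u , enqL x) ]
entering (slot (null _) _ _) = []

leaving : Slot → Timed
leaving (slot (value _ x w) _ f) = f , w , deqL (just x)
leaving (slot (null d) _ f) = f , d , deqL nothing

leaving-time : ∀ s → proj₁ (leaving s) ≡ leave s
leaving-time (slot (value _ _ _) _ _) = refl
leaving-time (slot (null _) _ _) = refl

_≤ᵗ_ : Timed → Timed → Set
(k , _) ≤ᵗ (k' , _) = k ≤ k'

-- What remains to be output when `es` have yet to enter and `q` is the queue. A NULL slot
-- contributes one event, through `leaving`.
pending : List Slot → List Slot → List Timed
pending es q = concatMap entering es ++ map leaving (q ++ es)

pending-≥ : ∀ {k} es q → All (λ s → k ≤ enter s) es → All (λ s → k ≤ leave s) (q ++ es) →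
            All (λ p → k ≤ proj₁ p) (pending es q)
pending-≥ {k} es q lo hi = Allₚ.++⁺ (entries es lo)
  (Allₚ.map⁺ (All.map (λ {s} → subst (k ≤_) (sym (leaving-time s))) hi))
  where
  entries : ∀ es → All (λ s → k ≤ enter s) es → All (λ p → k ≤ proj₁ p) (concatMap entering es)
  entries [] [] = []
  entries (slot (value _ _ _) _ _ ∷ es) (l ∷ ls) = l ∷ entries es ls
  entries (slot (null _) _ _ ∷ es) (l ∷ ls) = entries es ls

Schedule : List Slot → List Slot → Set
Schedule es q = ∃[ out ] (Run (map content q) (map (proj₂ ∘ proj₂) out) ×
                          AllPairs _≤ᵗ_ out × out ↭ pending es q)

AllPairs-dropˡ : ∀ {R : A → A → Set} (xs : List A) {ys} → AllPairs R (xs ++ ys) → AllPairs R ys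
AllPairs-dropˡ [] ps = ps
AllPairs-dropˡ (_ ∷ xs) (_ ∷ ps) = AllPairs-dropˡ xs ps

-- The departure of `s` may come first because, by the hypotheses, no pending event is earlier.
-- `enter-first` and `null-first` are the other two moves of the merge.
leave-first : ∀ {s es q} → IsValue s → All (λ t → leave s ≤ enter t) es →
              All (s ≼_) (q ++ es) → Schedule es q → Schedule es (s ∷ q)
leave-first {s@(slot _ _ f)} {es} {q} value lo hi (out , run , sorted , perm) =
  leaving s ∷ out , step (deqS _ _) run ,
  All-resp-↭ (↭-sym perm) (pending-≥ es q lo (All.map proj₂ hi)) ∷ sorted ,
  ↭-trans (prep _ perm) (↭-sym (shift (leaving s) (concatMap entering es) _))

enter-first : ∀ {u x w e f es q} → let t = slot (value u x w) e f in
              All (λ t' → e ≤ enter t') es → All (λ s → e ≤ leave s) (q ++ t ∷ es) →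
              Schedule es (q ++ [ t ]) → Schedule (t ∷ es) q
enter-first {u} {x} {w} {e} {f} {es} {q} lo hi (out , run , sorted , perm) =
  (e , u , enqL x) ∷ out ,
  step (enqS _ x) (subst (λ zs → Run zs _) (map-++ content q _) run) ,
  All-resp-↭ (↭-sym perm) (pending-≥ es (q ++ _) lo (subst (All _) (sym (++-assoc q _ es)) hi)) ∷ sorted ,
  prep _ (subst (λ zs → out ↭ concatMap entering es ++ map leaving zs) (++-assoc q _ es) perm)

null-first : ∀ {d e es} → let t = slot (null d) e e in
             All (t ≼_) es → Schedule es [] → Schedule (t ∷ es) []
null-first {d} {e} {es} hi (out , run , sorted , perm) =
  (e , d , deqL nothing) ∷ out , step nullS run ,
  All-resp-↭ (↭-sym perm) (pending-≥ es [] (All.map proj₁ hi) (All.map proj₂ hi)) ∷ sorted ,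
  ↭-trans (prep _ perm) (↭-sym (shift _ (concatMap entering es) _))

-- Quantifying over `q` lets the induction on `es` move a slot from `es` to the end of the queue.
Schedulable : List Slot → Set
Schedulable es = ∀ q → AllPairs _≼_ (q ++ es) → All Proper (q ++ es) → All IsValue q → Schedule es q

schedule-[] : Schedulable []
schedule-[] [] _ _ _ = [] , done [] , [] , ↭-refl
schedule-[] (s ∷ q) (s≼ ∷ ps) (_ ∷ proper) (v ∷ vs) =
  leave-first v [] s≼ (schedule-[] q ps proper vs)

-- The head of the queue leaves if its time is at most the entry of `t`; otherwise `t` enters. Ties
-- favour leaving, so a NULL slot always finds the queue empty: everything ahead of it leaves no
-- later than its instant.
schedule-∷ : ∀ t {es} → Schedulable es → Schedulable (t ∷ es)
schedule-∷ (slot (null d) e .e) rec [] (t≼ ∷ ps) (null ∷ proper) [] =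
  null-first t≼ (rec [] ps proper [])
schedule-∷ t@(slot (value u x w) e f) rec [] (t≼ ∷ ps) (value e≤f ∷ proper) [] =
  enter-first {q = []} (All.map proj₁ t≼)
    (e≤f ∷ All.map (λ (t≼s , p) → ≤-trans (proj₁ t≼s) (proper⇒≤ p)) (All.zip (t≼ , proper)))
    (rec [ t ] (t≼ ∷ ps) (value e≤f ∷ proper) (value ∷ []))
schedule-∷ t rec (s ∷ q) (s≼ ∷ ps) (p ∷ proper) (v ∷ vs) with leave s ≤? enter t
schedule-∷ t {es} rec (s ∷ q) (s≼ ∷ ps) (p ∷ proper) (v ∷ vs) | yes f≤e
  with t≼ ∷ _ ← AllPairs-dropˡ q ps =
  leave-first v (f≤e ∷ All.map (≤-trans f≤e ∘ proj₁) t≼) s≼ (schedule-∷ t rec q ps proper vs)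
schedule-∷ (slot (null d) e e') rec (s ∷ q) (s≼ ∷ ps) (p ∷ proper) (v ∷ vs) | no f≰e
  with null ∷ _ ← Allₚ.++⁻ʳ q proper with s≼t ∷ _ ← Allₚ.++⁻ʳ q s≼ = ⊥-elim (f≰e (proj₂ s≼t))
schedule-∷ t@(slot (value u x w) e f) {es} rec (s ∷ q) (s≼ ∷ ps) (p ∷ proper) (v ∷ vs) | no f≰e
  with t≼ ∷ _ ← AllPairs-dropˡ q ps =
  enter-first {q = s ∷ q} (All.map proj₁ t≼)
    (≰⇒≥ f≰e ∷ All.map (λ s≼s' → ≤-trans (≰⇒≥ f≰e) (proj₂ s≼s')) s≼)
    (rec (s ∷ q ++ [ t ])
      (subst (AllPairs _≼_) (sym (++-assoc (s ∷ q) [ t ] es)) (s≼ ∷ ps))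
      (subst (All Proper) (sym (++-assoc (s ∷ q) [ t ] es)) (p ∷ proper))
      (v ∷ Allₚ.++⁺ vs (value ∷ [])))

-- Merges the enqueues of es, in this order, with the dequeues of q ++ es, in this order.
schedule : ∀ es → Schedulable es
schedule [] = schedule-[]
schedule (t ∷ es) = schedule-∷ t (schedule es)

-- Distinctness of the scheduled events.

AllPairs-resp-↭ : ∀ {R : A → A → Set} {xs ys} → Symmetric R → xs ↭ ys → AllPairs R xs → AllPairs R ys
AllPairs-resp-↭ {R = R} symm perm = Permₛ.AllPairs-resp-↭ (setoid _) symm (resp₂ R) (↭⇒↭ₛ perm)

Pointwise-∈ˡ : ∀ {R : A → B → Set} {xs ys x} → Pointwise R xs ys → x ∈ xs → ∃[ y ] (y ∈ ys × R x y)
Pointwise-∈ˡ (r ∷ _) (here refl) = _ , here refl , r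
Pointwise-∈ˡ (_ ∷ rs) (there m) = let y , n , r = Pointwise-∈ˡ rs m in y , there n , r

Pointwise-∈ʳ : ∀ {R : A → B → Set} {xs ys y} → Pointwise R xs ys → y ∈ ys → ∃[ x ] (x ∈ xs × R x y)
Pointwise-∈ʳ (r ∷ _) (here refl) = _ , here refl , r
Pointwise-∈ʳ (_ ∷ rs) (there m) = let x , n , r = Pointwise-∈ʳ rs m in x , there n , r

-- Values are compared by `x` alone: it occurs in the labels and so separates the events, whereas
-- values that are never dequeued will share the same `w`.
_#_ : Kind → Kind → Set
value _ x _ # value _ y _ = x ≢ y
value _ _ _ # null _      = ⊤
null _      # value _ _ _ = ⊤
null d      # null d'     = d ≢ d'

#-sym : Symmetric _#_
#-sym {value _ _ _} {value _ _ _} x≢y = ≢-sym x≢y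
#-sym {value _ _ _} {null _} _ = tt
#-sym {null _} {value _ _ _} _ = tt
#-sym {null _} {null _} d≢d' = ≢-sym d≢d'

_≢ᵉ_ : Timed → Timed → Set
(_ , e) ≢ᵉ (_ , e') = e ≢ e'

pending-distinct : ∀ ss → AllPairs (λ s t → kind s # kind t) ss → AllPairs _≢ᵉ_ (pending ss [])
pending-distinct ss ps =
  AllPairsₚ.++⁺ (enters ss ps) (AllPairsₚ.map⁺ (AllPairs.map (λ {s} {t} → leaves {s} {t}) ps)) (mixed ss)
  where
  fresh : ∀ u x w e ss → All (λ s → value u x w # kind s) ss →
          All ((e , u , enqL x) ≢ᵉ_) (concatMap entering ss)
  fresh u x w e [] [] = []
  fresh u x w e (slot (value _ _ _) _ _ ∷ ss) (x≢y ∷ ps) = (λ { refl → x≢y refl }) ∷ fresh u x w e ss ps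
  fresh u x w e (slot (null _) _ _ ∷ ss) (_ ∷ ps) = fresh u x w e ss ps

  enters : ∀ ss → AllPairs (λ s t → kind s # kind t) ss → AllPairs _≢ᵉ_ (concatMap entering ss)
  enters [] [] = []
  enters (slot (value u x w) e _ ∷ ss) (p ∷ ps) = fresh u x w e ss p ∷ enters ss ps
  enters (slot (null _) _ _ ∷ ss) (_ ∷ ps) = enters ss ps

  leaves : ∀ {s t} → kind s # kind t → leaving s ≢ᵉ leaving t
  leaves {slot (value _ _ _) _ _} {slot (value _ _ _) _ _} x≢y refl = x≢y refl
  leaves {slot (null _) _ _} {slot (null _) _ _} d≢d' refl = d≢d' refl
  leaves {slot (value _ _ _) _ _} {slot (null _) _ _} _ ()
  leaves {slot (null _) _ _} {slot (value _ _ _) _ _} _ ()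

  enq≢leaving : ∀ k {u x} ts → All ((k , u , enqL x) ≢ᵉ_) (map leaving ts)
  enq≢leaving k [] = []
  enq≢leaving k (slot (value _ _ _) _ _ ∷ ts) = (λ ()) ∷ enq≢leaving k ts
  enq≢leaving k (slot (null _) _ _ ∷ ts) = (λ ()) ∷ enq≢leaving k ts

  mixed : ∀ ss' → All (λ t → All (t ≢ᵉ_) (map leaving ss)) (concatMap entering ss')
  mixed [] = []
  mixed (slot (value _ _ _) e _ ∷ ss') = enq≢leaving e ss ∷ mixed ss'
  mixed (slot (null _) _ _ ∷ ss') = mixed ss'

-- Timed runs inside prescribed intervals.

module Sequencing {A : Set} (a b c d : A → ℕ) (kindOf : A → Kind)
                  (a≤b : ∀ x → a x ≤ b x) (c≤d : ∀ x → c x ≤ d x) (a≤c : ∀ x → a x ≤ c x)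
                  (null-instant : ∀ {x n} → kindOf x ≡ null n → d x ≤ a x) where
  open IntervalOrder a b c d a≤b c≤d

  -- Running maxima of a and c: the earliest times compatible with the order of the list.
  slots : ℕ → ℕ → List A → List Slot
  slots m n [] = []
  slots m n (x ∷ xs) = slot (kindOf x) (m ⊔ a x) (n ⊔ c x) ∷ slots (m ⊔ a x) (n ⊔ c x) xs

  record Fits (x : A) (s : Slot) : Set where
    field
      same-kind : kind s ≡ kindOf x
      a≤enter : a x ≤ enter s
      enter≤b : enter s ≤ b x
      c≤leave : c x ≤ leave s
      leave≤d : leave s ≤ d x
  open Fits

  -- A running maximum of starts stays within the interval of `x`, because every earlier element is
  -- `⊑ x` and therefore starts no later than the interval of `x` ends.
  slots-fit : ∀ {m n xs} → All (λ x → m ≤ b x × n ≤ d x) xs → AllPairs _⊑_ xs →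
              Pointwise Fits xs (slots m n xs)
  slots-fit [] [] = []
  slots-fit {xs = x ∷ xs} ((m≤b , n≤d) ∷ bounds) (x⊑ ∷ ps) =
    record { same-kind = refl ; a≤enter = m≤n⊔m _ _ ; enter≤b = ⊔-lub m≤b (a≤b x)
           ; c≤leave = m≤n⊔m _ _ ; leave≤d = ⊔-lub n≤d (c≤d x) } ∷
    slots-fit (All.map (λ ((m≤b , n≤d) , p , q) → ⊔-lub m≤b p , ⊔-lub n≤d q) (All.zip (bounds , x⊑))) ps

  slots-≥ : ∀ m n xs → All (λ s → m ≤ enter s × n ≤ leave s) (slots m n xs)
  slots-≥ m n [] = []
  slots-≥ m n (x ∷ xs) = (m≤m⊔n m _ , m≤m⊔n n _) ∷
    All.map (λ (p , q) → ≤-trans (m≤m⊔n m _) p , ≤-trans (m≤m⊔n n _) q) (slots-≥ _ _ xs)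

  slots-sorted : ∀ m n xs → AllPairs _≼_ (slots m n xs)
  slots-sorted m n [] = []
  slots-sorted m n (x ∷ xs) = slots-≥ _ _ xs ∷ slots-sorted _ _ xs

  -- Running maxima of `a` stay below those of `c`. For a NULL element the slot also leaves by
  -- `d x`, hence by `a x` and by its entry, so both times coincide.
  slots-proper : ∀ {m n xs} → m ≤ n → Pointwise Fits xs (slots m n xs) → All Proper (slots m n xs)
  slots-proper {xs = []} _ [] = []
  slots-proper {xs = x ∷ xs} m≤n (fit ∷ fits) =
    proper (kindOf x) refl fit ∷ slots-proper (⊔-mono-≤ m≤n (a≤c x)) fits
    where
    e≤f = ⊔-mono-≤ m≤n (a≤c x)
    proper : ∀ κ → kindOf x ≡ κ → Fits x (slot (kindOf x) _ _) → Proper (slot κ _ _)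
    proper (value _ _ _) _ _ = value e≤f
    proper (null _) eq fit =
      subst (λ f → Proper (slot _ _ f))
        (≤-antisym e≤f (≤-trans (leave≤d fit) (≤-trans (null-instant eq) (a≤enter fit)))) null

  slots-kinds : ∀ {R : Kind → Kind → Set} m n xs → AllPairs (λ x y → R (kindOf x) (kindOf y)) xs →
                AllPairs (λ s t → R (kind s) (kind t)) (slots m n xs)
  slots-kinds m n [] [] = []
  slots-kinds {R} m n (x ∷ xs) (p ∷ ps) = heads _ _ xs p ∷ slots-kinds _ _ xs ps
    where
    heads : ∀ m n ys → All (λ y → R (kindOf x) (kindOf y)) ys →
            All (λ s → R (kindOf x) (kind s)) (slots m n ys)
    heads m n [] [] = []
    heads m n (y ∷ ys) (q ∷ qs) = q ∷ heads _ _ ys qs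

  data Occurs (x : A) : Timed → Set where
    enqueue : ∀ {u v w k} → kindOf x ≡ value u v w → a x ≤ k → k ≤ b x → Occurs x (k , u , enqL v)
    dequeue : ∀ {u v w k} → kindOf x ≡ value u v w → c x ≤ k → k ≤ d x →
              Occurs x (k , w , deqL (just v))
    empty   : ∀ {n k} → kindOf x ≡ null n → c x ≤ k → k ≤ d x → Occurs x (k , n , deqL nothing)

  entering-occurs : ∀ {x s t} → Fits x s → t ∈ entering s → Occurs x t
  entering-occurs {s = slot (value _ _ _) _ _} fit (here refl) =
    enqueue (sym (same-kind fit)) (a≤enter fit) (enter≤b fit)

  leaving-occurs : ∀ {x s} → Fits x s → Occurs x (leaving s)
  leaving-occurs {s = slot (value _ _ _) _ _} fit = dequeue (sym (same-kind fit)) (c≤leave fit) (leave≤d fit)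
  leaving-occurs {s = slot (null _) _ _} fit = empty (sym (same-kind fit)) (c≤leave fit) (leave≤d fit)

  record Sequence (xs : List A) : Set where
    field
      timed    : List Timed
      legal    : Legal (map (proj₂ ∘ proj₂) timed)
      sorted   : AllPairs _≤ᵗ_ timed
      distinct : AllPairs _≢ᵉ_ timed
      origin   : ∀ {t} → t ∈ timed → ∃[ x ] Occurs x t
      enqueued : ∀ {x u v w} → x ∈ xs → kindOf x ≡ value u v w →
                 ∃[ k ] (k ≤ b x × (k , u , enqL v) ∈ timed)
      dequeued : ∀ {x u v w} → x ∈ xs → kindOf x ≡ value u v w →
                 ∃[ k ] (k ≤ d x × (k , w , deqL (just v)) ∈ timed)
      emptied  : ∀ {x n} → x ∈ xs → kindOf x ≡ null n →
                 ∃[ k ] (k ≤ d x × (k , n , deqL nothing) ∈ timed)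

  sequence : ∀ xs → NonConflicting xs → AllPairs (λ x y → kindOf x # kindOf y) xs → Sequence xs
  sequence xs nc dist with ys , ys↭xs , ordered ← order xs nc = result
    where
    ss : List Slot
    ss = slots 0 0 ys
    fits : Pointwise Fits ys ss
    fits = slots-fit (All.tabulate λ _ → z≤n , z≤n) ordered
    result : Sequence xs
    result with out , run , sorted , perm ← schedule ss [] (slots-sorted 0 0 ys) (slots-proper z≤n fits) [] =
      record
      { timed = out ; legal = run ; sorted = sorted
      ; distinct = AllPairs-resp-↭ (λ {t} {t'} → ≢-sym) (↭-sym perm)
          (pending-distinct ss (slots-kinds {R = _#_} 0 0 ys
            (AllPairs-resp-↭ (λ {x} {y} → #-sym {kindOf x} {kindOf y}) (↭-sym ys↭xs) dist)))
      ; origin = λ m → origin (∈-++⁻ (concatMap entering ss) (∈-resp-↭ perm m))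
      ; enqueued = enqueued ; dequeued = dequeued ; emptied = emptied }
      where
      slot-of : ∀ {x} → x ∈ xs → ∃[ s ] (s ∈ ss × Fits x s)
      slot-of m = Pointwise-∈ˡ fits (∈-resp-↭ (↭-sym ys↭xs) m)

      origin : ∀ {t} → t ∈ concatMap entering ss ⊎ t ∈ map leaving ss → ∃[ x ] Occurs x t
      origin (inj₁ m) with s , s∈ , n ← find (∈-concatMap⁻ entering {xs = ss} m)
        with x , _ , fit ← Pointwise-∈ʳ fits s∈ = x , entering-occurs fit n
      origin (inj₂ m) with s , s∈ , refl ← ∈-map⁻ leaving m
        with x , _ , fit ← Pointwise-∈ʳ fits s∈ = x , leaving-occurs fit

      back : ∀ {t} → t ∈ pending ss [] → t ∈ out
      back = ∈-resp-↭ (↭-sym perm)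

      enqueued : ∀ {x u v w} → x ∈ xs → kindOf x ≡ value u v w →
                 ∃[ k ] (k ≤ b x × (k , u , enqL v) ∈ out)
      enqueued m eq with slot κ e f , s∈ , fit ← slot-of m with refl ← trans (same-kind fit) eq =
        e , enter≤b fit , back (∈-++⁺ˡ (∈-concatMap⁺ entering (lose s∈ (here refl))))

      dequeued : ∀ {x u v w} → x ∈ xs → kindOf x ≡ value u v w →
                 ∃[ k ] (k ≤ d x × (k , w , deqL (just v)) ∈ out)
      dequeued m eq with slot κ e f , s∈ , fit ← slot-of m with refl ← trans (same-kind fit) eq =
        f , leave≤d fit , back (∈-++⁺ʳ (concatMap entering ss) (∈-map⁺ leaving s∈))

      emptied : ∀ {x n} → x ∈ xs → kindOf x ≡ null n →
                ∃[ k ] (k ≤ d x × (k , n , deqL nothing) ∈ out)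
      emptied m eq with slot κ e f , s∈ , fit ← slot-of m with refl ← trans (same-kind fit) eq =
        f , leave≤d fit , back (∈-++⁺ʳ (concatMap entering ss) (∈-map⁺ leaving s∈))

-- Prefixes of runs, lists sorted by time, and finite searches.

run-prefix : ∀ {q} ls {ls'} → Run q (ls ++ ls') → Run q ls
run-prefix [] _ = done _
run-prefix (_ ∷ ls) (step s r) = step s (run-prefix ls r)

split-at-time : ∀ n (ts : List Timed) → AllPairs _≤ᵗ_ ts →
  ∃[ p ] ∃[ q ] (ts ≡ p ++ q × All (λ t → proj₁ t < n) p × All (λ t → n ≤ proj₁ t) q)
split-at-time n [] [] = [] , [] , refl , [] , []
split-at-time n (t ∷ ts) (t≤ ∷ ps) with proj₁ t <? n
... | no t≮n = [] , t ∷ ts , refl , [] , ≮⇒≥ t≮n ∷ All.map (≤-trans (≮⇒≥ t≮n)) t≤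
... | yes t<n = let p , q , eq , lo , hi = split-at-time n ts ps in
  t ∷ p , q , cong (t ∷_) eq , t<n ∷ lo , hi

sorted⇒before : ∀ {ts : List Timed} {k k' e e'} → AllPairs _≤ᵗ_ ts → (k , e) ∈ ts → (k' , e') ∈ ts →
                k < k' → Before (map proj₂ ts) e e'
sorted⇒before _ (here refl) (here refl) k<k' = ⊥-elim (<-irrefl refl k<k')
sorted⇒before _ (here refl) (there n) _ = before-head (∈-map⁺ proj₂ n)
sorted⇒before (t≤ ∷ _) (there m) (here refl) k<k' = ⊥-elim (<⇒≱ k<k' (All.lookup t≤ m))
sorted⇒before (_ ∷ ps) (there m) (there n) k<k' = before-∷ (sorted⇒before ps m n k<k')

AllPairs-takeˡ : ∀ {R : A → A → Set} (xs : List A) {ys} → AllPairs R (xs ++ ys) → AllPairs R xs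
AllPairs-takeˡ [] _ = []
AllPairs-takeˡ (_ ∷ xs) (p ∷ ps) = Allₚ.++⁻ˡ xs p ∷ AllPairs-takeˡ xs ps

module _ {A : Set} {G : A → Set} {W : Set} where

  -- A constructive search through a finite list, in place of excluded middle.
  all-or : ∀ {xs} → (∀ {x} → x ∈ xs → G x ⊎ W) → (∀ {x} → x ∈ xs → G x) ⊎ W
  all-or {[]} _ = inj₁ λ ()
  all-or {x ∷ xs} f with f (here refl) | all-or (f ∘ there)
  ... | inj₂ w | _ = inj₂ w
  ... | inj₁ _ | inj₂ w = inj₂ w
  ... | inj₁ g | inj₁ gs = inj₁ λ { (here refl) → g ; (there m) → gs m }

∃-or-∀ : ∀ {G W : ℕ → Set} i n → (∀ p → G p ⊎ W p) →
         (∃[ p ] (i ≤ p × p < n × G p)) ⊎ (∀ {p} → i ≤ p → p < n → W p)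
∃-or-∀ i zero f = inj₂ λ _ ()
∃-or-∀ i (suc n) f with f n | ∃-or-∀ i n f
... | _ | inj₁ (p , i≤p , p<n , g) = inj₁ (p , i≤p , m<n⇒m<1+n p<n , g)
... | inj₁ g | inj₂ ws with i ≤? n
...   | yes i≤n = inj₁ (n , i≤n , ≤-refl , g)
...   | no i≰n = inj₂ λ i≤p p<1+n → ⊥-elim (i≰n (≤-trans i≤p (s≤s⁻¹ p<1+n)))
∃-or-∀ i (suc n) f | inj₂ w | inj₂ ws = inj₂ λ i≤p p<1+n → below i≤p (m≤n⇒m<n∨m≡n (s≤s⁻¹ p<1+n))
  where
  below : ∀ {p} → i ≤ p → p < n ⊎ p ≡ n → _
  below i≤p (inj₁ p<n) = ws i≤p p<n
  below _ (inj₂ refl) = w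

-- One action stands for each element to be sequenced: the invocation of its enqueue for a value,
-- the response for a NULL dequeue.
data Anchor : Action → Set where
  enqueue    : ∀ u x → Anchor (inv u (enq x))
  null-reply : ∀ d → Anchor (res d (ret nothing))

anchor? : ∀ a → Dec (Anchor a)
anchor? (inv u (enq x)) = yes (enqueue u x)
anchor? (inv u deq) = no λ ()
anchor? (res u ok) = no λ ()
anchor? (res u (ret nothing)) = yes (null-reply u)
anchor? (res u (ret (just x))) = no λ ()

-- `k` is the offset of `xs` in the whole history. The strictly increasing positions later show that
-- the collected elements are distinct.
collect : ∀ {B : Set} (pos : B → ℕ) (anchor : B → Action) (xs : List Action) k →
          (∀ {i a} → At xs i a → Anchor a → ∃[ b ] (pos b ≡ k + i × anchor b ≡ a)) →
          ∃[ ys ] (All (λ y → k ≤ pos y) ys × AllPairs (λ y y' → pos y < pos y') ys ×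
                   (∀ {a} → a ∈ xs → Anchor a → ∃[ y ] (y ∈ ys × anchor y ≡ a)))
collect pos anchor [] k f = [] , [] , [] , λ ()
collect pos anchor (a ∷ xs) k f
  with ys , lo , ps , cover ← collect pos anchor xs (suc k) (λ m α →
         let b , eq , eq' = f (there m) α in b , trans eq (+-suc k _) , eq')
  with anchor? a
... | no ¬α = ys , All.map <⇒≤ lo , ps , λ { (here refl) α → ⊥-elim (¬α α) ; (there m) → cover m }
... | yes α with b , eq , eq' ← f here α =
  b ∷ ys , ≤-reflexive (sym eq₀) ∷ All.map <⇒≤ lo ,
  All.map (λ k<y → subst (_< _) (sym eq₀) k<y) lo ∷ ps ,
  λ { (here refl) _ → b , here refl , eq'
    ; (there m) β → let y , n , e = cover m β in y , there n , e }
  where eq₀ = trans eq (+-identityʳ k)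

-- Complete histories without violations have a legal ordering.

module Completeness {h : History} (wf : WF h) (complete : Complete h) (once : EnqOnce h)
                    (¬violation : ¬ Violation h) where
  open WellFormed wf

  ¬fresh : ¬ VFresh h
  ¬fresh = ¬violation ∘ inj₁
  ¬repet : ¬ VRepet h
  ¬repet = ¬violation ∘ inj₂ ∘ inj₁
  ¬ord : ¬ VOrd h
  ¬ord = ¬violation ∘ inj₂ ∘ inj₂ ∘ inj₁
  ¬wit : ¬ VWit h
  ¬wit = ¬violation ∘ inj₂ ∘ inj₂ ∘ inj₂

  DequeuedBy : ℕ → ℕ → ℕ → ℕ → Set
  DequeuedBy x w j k = At h j (inv w deq) × At h k (res w (ret (just x)))

  dequeuedBy⇒DeqE : ∀ {x w j k} → DequeuedBy x w j k → DeqE h w (just x)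
  dequeuedBy⇒DeqE (p , q) = at⇒∈ p , at⇒∈ q

  dequeuer-unique : ∀ {x w w'} → DeqE h w (just x) → DeqE h w' (just x) → w ≡ w'
  dequeuer-unique {x} {w} {w'} p q with w ≟ w'
  ... | yes eq = eq
  ... | no w≢w' = ⊥-elim (¬repet (w , w' , x , w≢w' , p , q))

  dequeuer? : ∀ x → (∀ w → ¬ DeqE h w (just x)) ⊎ (∃[ w ] DeqE h w (just x))
  dequeuer? x with all-or {G = λ a → ∀ w → a ≢ res w (ret (just x))} search
    where
    search : ∀ {a} → a ∈ h → (∀ w → a ≢ res w (ret (just x))) ⊎ (∃[ w ] DeqE h w (just x))
    search {inv _ _} _ = inj₁ λ _ ()
    search {res _ ok} _ = inj₁ λ _ ()
    search {res _ (ret nothing)} _ = inj₁ λ _ ()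
    search {res w (ret (just y))} m with x ≟ y
    ... | no x≢y = inj₁ λ { _ refl → x≢y refl }
    ... | yes refl with _ , _ , _ , p , deq-ret _ ← res-inv (proj₂ (∈⇒at m)) = inj₂ (w , at⇒∈ p , m)
  ... | inj₁ none = inj₁ λ w (_ , m) → none m w refl
  ... | inj₂ found = inj₂ found

  enqueuer : ∀ {x d} → DeqE h d (just x) → ∃[ u ] EnqE h u x
  enqueuer {x} {d} deq-x with all-or {G = λ a → ∀ u → a ≢ inv u (enq x)} search
    where
    search : ∀ {a} → a ∈ h → (∀ u → a ≢ inv u (enq x)) ⊎ (∃[ u ] EnqE h u x)
    search {res _ _} _ = inj₁ λ _ ()
    search {inv _ deq} _ = inj₁ λ _ ()
    search {inv u (enq y)} m with x ≟ y
    ... | no x≢y = inj₁ λ { _ refl → x≢y refl }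
    ... | yes refl = inj₂ (u , m)
  ... | inj₁ none = ⊥-elim (¬fresh (x , d , deq-x , inj₁ λ u m → none m u refl))
  ... | inj₂ found = found

  -- Forms of the condition in `VWit` and of its failure, for the prefix through position `p`:
  -- `Uncovered p` marks a moment at which the queue can be empty.
  Covered Uncovered : ℕ → Set
  Covered p = ∃[ x ] ∃[ u ] ∃[ i ] ∃[ r ] (At h i (inv u (enq x)) × At h r (res u ok) × r ≤ p ×
    (∀ {w j} t → At h j (inv w deq) → j ≤ p → res w (ret t) ∈ h → t ≢ just x))
  Uncovered p = ∀ {u x r} → inv u (enq x) ∈ h → At h r (res u ok) → r ≤ p →
    ∃[ w ] ∃[ j ] ∃[ k ] (DequeuedBy x w j k × j ≤ p)

  uncovered? : ∀ p → Uncovered p ⊎ Covered p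
  uncovered? p with all-or {G = Good} search
    where
    Good : Action → Set
    Good a = ∀ {u x r} → a ≡ inv u (enq x) → At h r (res u ok) → r ≤ p →
             ∃[ w ] ∃[ j ] ∃[ k ] (DequeuedBy x w j k × j ≤ p)
    search : ∀ {a} → a ∈ h → Good a ⊎ Covered p
    search {res _ _} _ = inj₁ λ ()
    search {inv _ deq} _ = inj₁ λ ()
    search {inv u (enq x)} m
      with i , at-i ← ∈⇒at m
      with r , at-r ← ∈⇒at (proj₂ (enq-event complete m))
      with r ≤? p
    ... | no r≰p = inj₁ λ { refl at-r' r'≤p → ⊥-elim (r≰p (subst (_≤ p) (res-injective at-r' at-r) r'≤p)) }
    ... | yes r≤p with dequeuer? x
    ...   | inj₁ none = inj₂ (x , u , i , r , at-i , at-r , r≤p ,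
              λ { _ at-w _ m' refl → none _ (at⇒∈ at-w , m') })
    ...   | inj₂ (w , inv-w , res-w)
      with j , at-j ← ∈⇒at inv-w
      with k , at-k ← ∈⇒at res-w
      with j ≤? p
    ...     | yes j≤p = inj₁ λ { refl _ _ → w , j , k , (at-j , at-k) , j≤p }
    ...     | no j≰p = inj₂ (x , u , i , r , at-i , at-r , r≤p , late)
      where
      late : ∀ {w' j'} t → At h j' (inv w' deq) → j' ≤ p → res w' (ret t) ∈ h → t ≢ just x
      late _ at-j' j'≤p m' refl with refl ← dequeuer-unique (inv-w , res-w) (at⇒∈ at-j' , m') =
        j≰p (subst (_≤ p) (inv-injective at-j' at-j) j'≤p)
  ... | inj₁ good = inj₁ λ m → good m refl
  ... | inj₂ c = inj₂ c

  -- If every position from the invocation of `d` up to its response were covered, each split of the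
  -- interval would have a witness, which is `VWit`.
  null-pivot : ∀ {d i r} → At h i (inv d deq) → At h r (res d (ret nothing)) →
               ∃[ p ] (i ≤ p × p < r × Uncovered p)
  null-pivot {d} {i} {r} at-i at-r with ∃-or-∀ i r uncovered?
  ... | inj₁ found = found
  ... | inj₂ covered with c₀ , cd , c₃ , h≡ ← at⇒before at-i at-r (inv<res at-i at-r) =
    ⊥-elim (¬wit (d , c₀ , cd , c₃ , h≡ , witness))
    where
    i≡ : i ≡ length c₀
    i≡ = inv-injective at-i (subst (λ zs → At zs _ _) (sym h≡) (at-length c₀))
    r≡ : r ≡ length (c₀ ++ inv d deq ∷ cd)
    r≡ = res-injective at-r (subst (λ zs → At zs _ _) (trans (++-assoc c₀ _ _) (sym h≡))
                                   (at-length (c₀ ++ inv d deq ∷ cd)))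

    witness : ∀ c₁ c₂ → cd ≡ c₁ ++ c₂ → ∃[ x ] ∃[ u ]
      (inv u (enq x) ∈ c₀ ++ inv d deq ∷ c₁ × res u ok ∈ c₀ ++ inv d deq ∷ c₁ ×
       (∀ d' t → inv d' deq ∈ c₀ ++ inv d deq ∷ c₁ → res d' (ret t) ∈ h → t ≢ just x))
    witness c₁ c₂ refl = x , u ,
      in-prefix at-u (≤-trans (<⇒≤ (inv<res at-u at-ok)) k≤p) , in-prefix at-ok k≤p ,
      λ d' t m → let j , j≤p , at-j = in-h m in undequeued t at-j j≤p
      where
      prefix rest : History
      prefix = c₀ ++ inv d deq ∷ c₁
      rest = c₂ ++ res d (ret nothing) ∷ c₃
      h≡' : h ≡ prefix ++ rest
      h≡' = trans h≡ (trans (cong (λ zs → c₀ ++ inv d deq ∷ zs) (++-assoc c₁ c₂ _))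
                            (sym (++-assoc c₀ _ _)))
      -- The last position of `prefix`, whose length is `suc p` since it also contains the
      -- invocation of `d`.
      p : ℕ
      p = length c₀ + length c₁
      len : length prefix ≡ suc p
      len = trans (length-++ c₀) (+-suc _ _)
      p<r : p < r
      p<r = subst₂ _≤_ len
        (sym (trans r≡ (trans (cong length (sym (++-assoc c₀ (inv d deq ∷ c₁) c₂))) (length-++ prefix))))
        (m≤m+n (length prefix) (length c₂))
      in-h : ∀ {a} → a ∈ prefix → ∃[ j ] (j ≤ p × At h j a)
      in-h m with j , lt , q ← ∈-prefix {q = rest} m =
        j , s≤s⁻¹ (subst (j <_) len lt) , subst (λ zs → At zs j _) (sym h≡') q
      in-prefix : ∀ {j a} → At h j a → j ≤ p → a ∈ prefix
      in-prefix {j} q j≤p = at-prefix prefix (subst (λ zs → At zs j _) h≡' q)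
                              (subst (j <_) (sym len) (s≤s j≤p))
      cov : Covered p
      cov = covered (subst (_≤ p) (sym i≡) (m≤m+n _ _)) p<r
      x = proj₁ cov
      u = proj₁ (proj₂ cov)
      at-u = proj₁ (proj₂ (proj₂ (proj₂ (proj₂ cov))))
      at-ok = proj₁ (proj₂ (proj₂ (proj₂ (proj₂ (proj₂ cov)))))
      k≤p = proj₁ (proj₂ (proj₂ (proj₂ (proj₂ (proj₂ (proj₂ cov))))))
      undequeued = proj₂ (proj₂ (proj₂ (proj₂ (proj₂ (proj₂ (proj₂ cov))))))

  -- The two intervals of values and of NULL dequeues.

  N : ℕ
  N = length h

  -- An undequeued value is given a dequeue by the junk event 0 at time N, after the history.
  data Fate (x : ℕ) : ℕ → ℕ → ℕ → Set where
    dequeued   : ∀ {w j k} → DequeuedBy x w j k → Fate x w j k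
    undequeued : (∀ w → ¬ DeqE h w (just x)) → Fate x 0 N N

  data Item : Set where
    value : ∀ u x w i r j k → At h i (inv u (enq x)) → At h r (res u ok) → Fate x w j k → Item
    null  : ∀ d i r p → At h i (inv d deq) → At h r (res d (ret nothing)) →
            i ≤ p → p < r → Uncovered p → Item

  kindOf : Item → Kind
  kindOf (value u x w _ _ _ _ _ _ _) = value u x w
  kindOf (null d _ _ _ _ _ _ _ _) = null d

  -- The response, not the pivot `p`, locates a NULL dequeue, since pivots of different NULL
  -- dequeues may coincide.
  pos : Item → ℕ
  pos (value _ _ _ i _ _ _ _ _ _) = i
  pos (null _ _ r _ _ _ _ _ _) = r

  anchor : Item → Action
  anchor (value u x _ _ _ _ _ _ _ _) = inv u (enq x)
  anchor (null d _ _ _ _ _ _ _ _) = res d (ret nothing)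

  item-at : ∀ {i a} → At h i a → Anchor a → ∃[ y ] (pos y ≡ i × anchor y ≡ a)
  item-at {i} at-i (enqueue u x) with r , at-r ← ∈⇒at (proj₂ (enq-event complete (at⇒∈ at-i)))
    with dequeuer? x
  ... | inj₁ none = value u x 0 i r N N at-i at-r (undequeued none) , refl , refl
  ... | inj₂ (w , inv-w , res-w) with j , at-j ← ∈⇒at inv-w with k , at-k ← ∈⇒at res-w =
    value u x w i r j k at-i at-r (dequeued (at-j , at-k)) , refl , refl
  item-at {r} at-r (null-reply d) with i , _ , _ , at-i , deq-ret _ ← res-inv at-r
    with p , i≤p , p<r , unc ← null-pivot at-i at-r =
    null d i r p at-i at-r i≤p p<r unc , refl , refl

  distinct : ∀ {y y'} → pos y < pos y' → kindOf y # kindOf y'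
  distinct {value u x _ _ _ _ _ p _ _} {value u' .x _ _ _ _ _ q _ _} lt refl
    with refl ← once u u' x (at⇒∈ p) (at⇒∈ q) = <⇒≢ lt (inv-injective p q)
  distinct {value _ _ _ _ _ _ _ _ _ _} {null _ _ _ _ _ _ _ _ _} _ = tt
  distinct {null _ _ _ _ _ _ _ _ _} {value _ _ _ _ _ _ _ _ _ _} _ = tt
  distinct {null _ _ _ _ _ p _ _ _} {null _ _ _ _ _ q _ _ _} lt refl = <⇒≢ lt (res-injective p q)

  -- The enqueue of a value must take effect in [a , b] and its dequeue in [c , d].
  a b c d : Item → ℕ
  a (value _ _ _ i _ _ _ _ _ _) = i
  a (null _ _ _ p _ _ _ _ _) = p
  b (value _ _ _ _ r _ k _ _ _) = r ⊓ k
  b (null _ _ _ p _ _ _ _ _) = p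
  c (value _ _ _ i _ j _ _ _ _) = i ⊔ j
  c (null _ _ _ p _ _ _ _ _) = p
  d (value _ _ _ _ _ _ k _ _ _) = k
  d (null _ _ _ p _ _ _ _ _) = p

  -- A dequeue answered before the enqueue is invoked would be `VFresh`; without a dequeue, `k` is
  -- `N`, beyond all positions.
  enq≤deq : ∀ {u x w i j k} → At h i (inv u (enq x)) → Fate x w j k → i ≤ k
  enq≤deq {u} {x} {w} at-i (dequeued dq) = ≮⇒≥ λ k<i →
    ¬fresh (x , w , dequeuedBy⇒DeqE dq , inj₂ (u , at⇒∈ at-i , <⇒prec (proj₂ dq) at-i k<i))
  enq≤deq at-i (undequeued _) = <⇒≤ (at-< at-i)

  fate-≤ : ∀ {x w j k} → Fate x w j k → j ≤ k
  fate-≤ (dequeued (p , q)) = <⇒≤ (inv<res p q)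
  fate-≤ (undequeued _) = ≤-refl

  a≤b : ∀ y → a y ≤ b y
  a≤b (value _ _ _ _ _ _ _ p q fate) = ⊓-glb (<⇒≤ (inv<res p q)) (enq≤deq p fate)
  a≤b (null _ _ _ _ _ _ _ _ _) = ≤-refl

  c≤d : ∀ y → c y ≤ d y
  c≤d (value _ _ _ _ _ _ _ p _ fate) = ⊔-lub (enq≤deq p fate) (fate-≤ fate)
  c≤d (null _ _ _ _ _ _ _ _ _) = ≤-refl

  a≤c : ∀ y → a y ≤ c y
  a≤c (value _ _ _ _ _ _ _ _ _ _) = m≤m⊔n _ _
  a≤c (null _ _ _ _ _ _ _ _ _) = ≤-refl

  null-instant : ∀ {y n} → kindOf y ≡ null n → d y ≤ a y
  null-instant {null _ _ _ _ _ _ _ _ _} _ = ≤-refl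

  a≤d : ∀ y → a y ≤ d y
  a≤d y = ≤-trans (a≤c y) (c≤d y)

  min< : ∀ m n {o} → m ⊓ n < o → m < o ⊎ n < o
  min< m n lt with ⊓-sel m n
  ... | inj₁ eq = inj₁ (subst (_< _) eq lt)
  ... | inj₂ eq = inj₂ (subst (_< _) eq lt)

  <max : ∀ m n {o} → o < m ⊔ n → o < m ⊎ o < n
  <max m n lt with ⊔-sel m n
  ... | inj₁ eq = inj₁ (subst (_ <_) eq lt)
  ... | inj₂ eq = inj₂ (subst (_ <_) eq lt)

  -- Two values enqueued in one order and dequeued in the other form `VOrd`, in its first
  -- alternative if `x` is never dequeued. If `x'` is never dequeued, then `k'` is `N` and nothing
  -- lies beyond it.
  crossing-values : ∀ {u x w i r j k u' x' w' i' r' j' k'} →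
    At h i (inv u (enq x)) → At h r (res u ok) → Fate x w j k →
    At h i' (inv u' (enq x')) → At h r' (res u' ok) → Fate x' w' j' k' →
    r < i' → ¬ (k' < j)
  crossing-values {j = j} {k} _ _ fate _ _ (undequeued _) _ N<j =
    <⇒≱ N<j (≤-trans (fate-≤ fate) (bounded fate))
    where
    bounded : ∀ {x w j k} → Fate x w j k → k ≤ N
    bounded (dequeued (_ , q)) = <⇒≤ (at-< q)
    bounded (undequeued _) = ≤-refl
  crossing-values {u} {x} {u' = u'} {x'} {w'} at-i at-r (undequeued none) at-i' _ (dequeued dq') r<i' _ =
    ¬ord (x' , x , u' , u , w' , at⇒∈ at-i' , at⇒∈ at-i , <⇒prec at-r at-i' r<i' ,
          dequeuedBy⇒DeqE dq' , inj₁ none)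
  crossing-values {u} {x} {w} {u' = u'} {x'} {w'} at-i at-r (dequeued dq) at-i' _ (dequeued dq') r<i' k'<j =
    ¬ord (x' , x , u' , u , w' , at⇒∈ at-i' , at⇒∈ at-i , <⇒prec at-r at-i' r<i' ,
          dequeuedBy⇒DeqE dq' , inj₂ (w , dequeuedBy⇒DeqE dq , <⇒prec (proj₂ dq') (proj₁ dq) k'<j))

  -- Being uncovered provides a dequeue of `x` invoked by `p`, and uniqueness of the dequeuer
  -- identifies it with `w`.
  dequeue-invoked : ∀ {u x w r j k p} → inv u (enq x) ∈ h → At h r (res u ok) → Fate x w j k →
                    Uncovered p → r ≤ p → j ≤ p
  dequeue-invoked m at-r fate unc r≤p with w' , j' , k' , dq' , j'≤p ← unc m at-r r≤p | fate
  ... | undequeued none = ⊥-elim (none w' (dequeuedBy⇒DeqE dq'))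
  ... | dequeued dq with refl ← dequeuer-unique (dequeuedBy⇒DeqE dq) (dequeuedBy⇒DeqE dq') =
    subst (_≤ _) (inv-injective (proj₁ dq') (proj₁ dq)) j'≤p

  -- For a value `y`, `b y` is a minimum and `c y` a maximum, which gives several cases. All but
  -- `r < a y'` with `d y' < j` contradict the bounds on the intervals. In that case a value `y'`
  -- yields `VOrd`, and a NULL `y'` contradicts its pivot being uncovered.
  non-conflicting : ∀ y y' → b y < a y' → ¬ (d y' < c y)
  non-conflicting (null _ _ _ _ _ _ _ _ _) y' p<a d<p = <⇒≱ (<-trans d<p p<a) (a≤d y')
  non-conflicting y@(value u x w i r j k at-i at-r fate) y' b<a d<c with <max i j d<c
  ... | inj₁ d<i = <⇒≱ (<-trans d<i (≤-<-trans (a≤b y) b<a)) (a≤d y')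
  ... | inj₂ d<j with min< r k b<a
  ... | inj₂ k<a = <⇒≱ (≤-<-trans (a≤d y') d<j) (≤-trans (fate-≤ fate) (<⇒≤ k<a))
  non-conflicting (value u x w i r j k at-i at-r fate)
                  (value u' x' w' i' r' j' k' at-i' at-r' fate') b<a d<c | inj₂ k'<j | inj₁ r<i' =
    crossing-values at-i at-r fate at-i' at-r' fate' r<i' k'<j
  non-conflicting (value u x w i r j k at-i at-r fate)
                  (null _ _ _ p _ _ _ _ unc) b<a d<c | inj₂ p<j | inj₁ r<p =
    <⇒≱ p<j (dequeue-invoked (at⇒∈ at-i) at-r fate unc (<⇒≤ r<p))

  -- The legal ordering read off from the timed run.

  open Sequencing a b c d kindOf a≤b c≤d a≤c null-instant

  items : List Item
  items = proj₁ (collect pos anchor h 0 item-at)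

  item-for : ∀ {a} → a ∈ h → Anchor a → ∃[ y ] (y ∈ items × anchor y ≡ a)
  item-for = proj₂ (proj₂ (proj₂ (collect pos anchor h 0 item-at)))

  items-distinct : AllPairs (λ y y' → kindOf y # kindOf y') items
  items-distinct = AllPairs.map (λ {y} {y'} → distinct {y} {y'})
    (proj₁ (proj₂ (proj₂ (collect pos anchor h 0 item-at))))

  record Timely (t : Timed) : Set where
    field
      event   : EventOf h (proj₂ t)
      {from to} : ℕ
      {op}    : Op
      {reply} : Ret
      at-from : At h from (inv (proj₁ (proj₂ t)) op)
      at-to   : At h to (res (proj₁ (proj₂ t)) reply)
      from≤   : from ≤ proj₁ t
      ≤to     : proj₁ t ≤ to

  occurs⇒timely : ∀ {y t} → Occurs y t → proj₁ t < N → Timely t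
  occurs⇒timely {value _ _ _ _ _ _ _ p q _} (enqueue refl i≤t t≤) _ = record
    { event = at⇒∈ p , at⇒∈ q ; at-from = p ; at-to = q ; from≤ = i≤t ; ≤to = ≤-trans t≤ (m⊓n≤m _ _) }
  occurs⇒timely {value _ _ _ i _ j _ _ _ (dequeued (p , q))} (dequeue refl ≤t t≤) _ = record
    { event = at⇒∈ p , at⇒∈ q ; at-from = p ; at-to = q ; from≤ = ≤-trans (m≤n⊔m i j) ≤t ; ≤to = t≤ }
  -- A junk dequeue happens at time at least `i ⊔ N`, so the bound `t<N` rules it out.
  occurs⇒timely {value _ _ _ i _ _ _ _ _ (undequeued _)} (dequeue refl ≤t _) t<N =
    ⊥-elim (<⇒≱ t<N (≤-trans (m≤n⊔m i N) ≤t))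
  occurs⇒timely {null _ _ _ _ p q i≤p p<r _} (empty refl ≤t t≤) _ = record
    { event = at⇒∈ p , at⇒∈ q ; at-from = p ; at-to = q
    ; from≤ = ≤-trans i≤p ≤t ; ≤to = ≤-trans t≤ (<⇒≤ p<r) }

  open Sequence (sequence items (λ {y} {y'} _ _ → non-conflicting y y') items-distinct)
    renaming (distinct to timed-distinct; enqueued to enq-timed; dequeued to deq-timed; emptied to null-timed)

  -- Everything from time N on is a junk dequeue.
  cut : ∃[ p ] ∃[ q ] (timed ≡ p ++ q × All (λ t → proj₁ t < N) p × All (λ t → N ≤ proj₁ t) q)
  cut = split-at-time N timed sorted

  real : List Timed
  real = proj₁ cut

  timed≡ : timed ≡ real ++ proj₁ (proj₂ cut)
  timed≡ = proj₁ (proj₂ (proj₂ cut))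

  real-AllPairs : ∀ {R : Timed → Timed → Set} → AllPairs R timed → AllPairs R real
  real-AllPairs ps = AllPairs-takeˡ real (subst (AllPairs _) timed≡ ps)

  real⁺ : ∀ {k e} → (k , e) ∈ timed → k < N → e ∈ map proj₂ real
  real⁺ m k<N with ∈-++⁻ real (subst (_ ∈_) timed≡ m)
  ... | inj₁ n = ∈-map⁺ proj₂ n
  ... | inj₂ n = ⊥-elim (<⇒≱ k<N (All.lookup (proj₂ (proj₂ (proj₂ (proj₂ cut)))) n))

  real⁻ : ∀ {e} → e ∈ map proj₂ real → ∃[ k ] ((k , e) ∈ real × Timely (k , e))
  real⁻ m with (k , _) , n , refl ← ∈-map⁻ proj₂ m
    with y , occ ← origin (subst (_ ∈_) (sym timed≡) (∈-++⁺ˡ n)) =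
    k , n , occurs⇒timely occ (All.lookup (proj₁ (proj₂ (proj₂ (proj₂ cut)))) n)

  -- Each event of `h` is scheduled no later than its response, at a position below `N`, and thus
  -- survives the cut.
  covers : ∀ e → EventOf h e → e ∈ map proj₂ real
  covers (u , enqL x) (inv-u , _) with item-for inv-u (enqueue u x)
  ... | y@(value _ _ _ _ _ _ _ _ at-r _) , y∈ , refl with k , k≤b , m ← enq-timed y∈ refl =
    real⁺ m (≤-<-trans (≤-trans k≤b (m⊓n≤m _ _)) (at-< at-r))
  covers (w , deqL (just x)) event with u , inv-u ← enqueuer event with item-for inv-u (enqueue u x)
  ... | value _ _ _ _ _ _ _ _ _ (undequeued none) , _ , refl = ⊥-elim (none w event)
  ... | y@(value _ _ _ _ _ _ _ _ _ (dequeued dq)) , y∈ , refl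
    with refl ← dequeuer-unique event (dequeuedBy⇒DeqE dq)
    with k , k≤d , m ← deq-timed y∈ refl = real⁺ m (≤-<-trans k≤d (at-< (proj₂ dq)))
  covers (n , deqL nothing) (_ , res-n) with item-for res-n (null-reply n)
  ... | y@(null _ _ _ _ _ at-r _ p<r _) , y∈ , refl with k , k≤p , m ← null-timed y∈ refl =
    real⁺ m (≤-<-trans k≤p (<-trans p<r (at-< at-r)))

  real-legal : Legal (map proj₂ (map proj₂ real))
  real-legal = subst Legal (map-∘ real)
    (run-prefix (map (proj₂ ∘ proj₂) real)
      (subst Legal (trans (cong (map _) timed≡) (map-++ _ real _)) legal))

  -- The time of `e` is at most its response, which is strictly before the invocation of `e'` and so
  -- before its time. Ties in the sorted list therefore do no harm.
  respects : ∀ e e' → e ∈ map proj₂ real → e' ∈ map proj₂ real → Prec h (proj₁ e) (proj₁ e') →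
             Before (map proj₂ real) e e'
  respects e e' m m' prec with k , n , timely ← real⁻ m with k' , n' , timely' ← real⁻ m' =
    sorted⇒before (real-AllPairs sorted) n n'
      (≤-<-trans (≤to timely) (<-≤-trans (prec⇒< prec (at-to timely) (at-from timely')) (from≤ timely')))
    where open Timely

  legal-ordering : ∃[ s ] LegalOrdering h s
  legal-ordering = map proj₂ real , (λ e m → Timely.event (proj₂ (proj₂ (real⁻ m)))) , covers ,
    AllPairsₚ.map⁺ (real-AllPairs timed-distinct) , real-legal , respects

-- From complete histories to completable implementations.

theorem4p10 : (I : Implementation) →
    (∀ h → I h → WF h) →
    (∀ h → I h → EnqOnce h) →
    Completable I →
    (LinearizableImpl I ⇔ (∀ c → I c → Complete c → ¬ Violation c))
theorem4p10 I wf once completable = mk⇔ linearizable⇒¬violation ¬violation⇒linearizable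
  where
  linearizable⇒¬violation : LinearizableImpl I → ∀ c → I c → Complete c → ¬ Violation c
  linearizable⇒¬violation lin c Ic complete
    with ĉ , compl , s , ordering ← lin c Ic
    -- The linearized completion is `c` itself, because `c` is complete.
    with refl ← completion-of-complete complete compl =
    Soundness.¬violation (wf c Ic) complete (once c Ic) ordering

  ¬violation⇒linearizable : (∀ c → I c → Complete c → ¬ Violation c) → LinearizableImpl I
  ¬violation⇒linearizable ¬viol c Ic
    -- Completability supplies a completion that is again an induced history, so the absence of
    -- violations applies to it.
    with ĉ , compl@(c' , _ , _ , refl) , Iĉ ← completable c Ic =
    ĉ , compl , Completeness.legal-ordering (wf ĉ Iĉ) complete (once ĉ Iĉ) (¬viol ĉ Iĉ complete)
    where complete = dropPending-complete (c ++ c')
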